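{- For all processes $s,t$, $\mathbf{d}_T(s,t)=\sup_{\Psi\in\mathcal{L}^d}\left|[\![\Psi]\!](s)-[\![\Psi]\!](t)\right|$, where $[\![\Psi]\!](u)=1-D(\Psi,\mathcal{L}(u))$.
   Context: PTS $(\mathcal{S},A,\to)$ with finitely supported distributions; processes image-finite and finite. Computations $c=s_0\xrightarrow{a_1}\cdots\xrightarrow{a_n}s_n$ via transitions $s_{i-1}\xrightarrow{a_i}\pi_i$, $s_i\in\mathrm{supp}(\pi_i)$; $\Pr(c)=\prod\pi_i(s_i)$; $|c|=n$; $\mathrm{tr}(c)=a_1\cdots a_n$; maximal = not a proper prefix of another computation from the same process; $\mathcal{C}_{\max}(z)$, $\mathcal{C}_{\max}(z,\alpha)$ those with trace $\alpha$; $\Pr$ of a set is the sum. A resolution of $s$ is a PTS $\mathcal{Z}=(Z,A,\to_{\mathcal{Z}})$ with $\mathrm{corr}\colon Z\to\mathcal{S}$ and initial state $z_s$, $\mathrm{corr}(z_s)=s$, such that $z_s$ is in no target support, every other state is in the support of a target of a transition from a different state, every $z\xrightarrow{a}_{\mathcal{Z}}\pi$ is matched by $\mathrm{corr}(z)\xrightarrow{a}\pi'$ with $\pi(z')=\pi'(\mathrm{corr}(z'))$, and each state has at most one outgoing transition; $\mathrm{res}(s)$ the set of resolutions. $TD_{\mathcal{Z}}(\alpha)=\Pr(\mathcal{C}_{\max}(z,\alpha))$. Kantorovich lifting $\mathcal{K}(d)(\pi,\pi')=\min_\omega\sum\omega(x,y)d(x,y)$ over couplings; Hausdorff lifting $\mathcal{H}(\hat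 d)(X,Y)=\max\{\sup_{x\in X}\inf_{y\in Y}\hat d(x,y),\sup_{y\in Y}\inf_{x\in X}\hat d(y,x)\}$ ($\inf\emptyset=1$, $\sup\emptyset=0$). $d_T(\alpha,\beta)=0$ if $\alpha=\beta$ else $1$; $D_T(\mathcal{Z}_1,\mathcal{Z}_2)=\mathcal{K}(d_T)(TD_{\mathcal{Z}_1},TD_{\mathcal{Z}_2})$; strong trace metric $\mathbf{d}_T(s,t)=\mathcal{H}(D_T)(\mathrm{res}(s),\mathrm{res}(t))$. Logic: trace formulae $\Phi::=\top\mid\langle a\rangle\Phi$, $\mathrm{depth}(\top)=0$, $\mathrm{depth}(\langle a\rangle\Phi)=1+\mathrm{depth}(\Phi)$; $\mathcal{L}^d$ is the set of trace distribution formulae $\bigoplus_{i\in I}r_i\Phi_i$ ($I$ finite nonempty, $\Phi_i$ pairwise distinct, $r_i\in(0,1]$, $\sum r_i=1$), identified with distributions on trace formulae. $c\models\top$ always; $c\models\langle a\rangle\Phi$ iff $c=s\xrightarrow{a}c'$ with $c'\models\Phi$. $s\models\bigoplus_i r_i\Phi_i$ iff some $\mathcal{Z}\in\mathrm{res}(s)$ with initial state $z$ satisfies $\Pr(\{c\in\mathcal{C}_{\max}(z):c\models\Phi_i,|c|=\mathrm{depth}(\Phi_i)\})=r_i$ for all $i$; $\mathcal{L}(s)$ the set of formulae in $\mathcal{L}^d$ satisfied by $s$. $d(\Phi_1,\Phi_2)=0$ if equal, else 1; $D=\mathcal{K}(d)$ on $\mathcal{L}^d$; $D(\Psi,\mathcal{L}')=\inf_{\Psi'\in\mathcal{L}'}D(\Psi,\Psi')$.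 -}

module Defs where

open import Algebra.Apartness.Bundles using (HeytingCommutativeRing; HeytingField)
open import Algebra.Bundles using (CommutativeRing)
import Algebra.Construct.NaturalChoice.Max as NaturalMax
import Algebra.Definitions.RawMonoid as RawMonoidSum
open import Axiom.ExcludedMiddle using (ExcludedMiddle)
open import Data.Fin.Base using (Fin)
open import Data.List.Base using (List; []; _∷_; foldr; map)
open import Data.List.Membership.Propositional using (_∉_)
open import Data.List.Relation.Unary.All using (All)
open import Data.List.Relation.Unary.AllPairs using (AllPairs)
open import Data.List.Relation.Unary.Any using (Any)
open import Data.List.Relation.Unary.Unique.Propositional using (Unique)
open import Data.Nat.Base using (ℕ; zero; suc)
open import Data.Product.Base using (Σ; ∃; ∃-syntax; ∃₂; _×_; _,_; uncurry)
open import Function.Definitions using (Injective)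
open import Level using (Level; 0ℓ) renaming (suc to lsuc)
open import Relation.Binary.Bundles using (TotalOrder)
open import Relation.Binary.Core using (Rel)
open import Relation.Binary.PropositionalEquality.Core using (_≡_; _≢_)
open import Relation.Binary.Structures using (IsTotalOrder)
open import Relation.Nullary.Decidable.Core using (yes; no)
open import Relation.Nullary.Negation.Core using (¬_)
open import Relation.Unary using (Pred)

-- The real numbers are not in the library; they enter through their
-- axiomatic characterisation.  Completeness for Set-valued predicates
-- suffices: under excluded middle a predicate of any level is equivalent
-- to a Set-valued one.

record CompleteOrderedField : Set₁ where
  field
    heytingField : HeytingField 0ℓ 0ℓ 0ℓ

  open HeytingField heytingField public
  open HeytingCommutativeRing heytingCommutativeRing public using (commutativeRing)
  open CommutativeRing commutativeRing public using (+-rawMonoid)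

  infix 4 _≤_ _<_

  field
    _≤_          : Rel Carrier 0ℓ
    isTotalOrder : IsTotalOrder _≈_ _≤_
    +-monoˡ-≤    : ∀ z {x y} → x ≤ y → x + z ≤ y + z
    *-nonNeg     : ∀ {x y} → 0# ≤ x → 0# ≤ y → 0# ≤ x * y

  UpperBound : Pred Carrier 0ℓ → Pred Carrier 0ℓ
  UpperBound P u = ∀ {x} → P x → x ≤ u

  field
    complete : (P : Pred Carrier 0ℓ) → ∃ P → ∃ (UpperBound P) →
               ∃[ u ] UpperBound P u × (∀ {v} → UpperBound P v → u ≤ v)

  totalOrder : TotalOrder 0ℓ 0ℓ 0ℓ
  totalOrder = record { isTotalOrder = isTotalOrder }

  open NaturalMax totalOrder public using (_⊔_)

  _<_ : Rel Carrier 0ℓ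
  x < y = x ≤ y × ¬ x ≈ y

  ∣_∣ : Carrier → Carrier
  ∣ x ∣ = x ⊔ (- x)

infixr 9 ⟨_⟩_

data TraceFormula (A : Set) : Set where
  ⊤    : TraceFormula A
  ⟨_⟩_ : A → TraceFormula A → TraceFormula A

depth : ∀ {A} → TraceFormula A → ℕ
depth ⊤         = 0
depth (⟨ _ ⟩ Φ) = suc (depth Φ)

module Theory (lem : ∀ {ℓ} → ExcludedMiddle ℓ) (𝓡 : CompleteOrderedField) where

  open CompleteOrderedField 𝓡 public renaming (Carrier to ℝ)
  open RawMonoidSum +-rawMonoid public using () renaming (sum to sumFin)

  private variable
    a b : Level
    A X : Set

  -- Definite description.  Every P it is applied to below determines its
  -- witness up to _≈_; the value is 0# if there is no witness.
  the : (ℝ → Set a) → ℝ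
  the P with lem {P = ∃ P}
  ... | yes (x , _) = x
  ... | no  _       = 0#

  sumList : (X → ℝ) → List X → ℝ
  sumList f xs = foldr _+_ 0# (map f xs)

  -- f is finitely supported, with sum v.
  IsSum : (X → ℝ) → ℝ → Set
  IsSum f v = ∃[ xs ] Unique xs × (∀ {x} → x ∉ xs → f x ≈ 0#) × sumList f xs ≈ v

  ∑ : (X → ℝ) → ℝ
  ∑ f = the (IsSum f)

  -- Suprema and infima are taken in the lattice [0,1], where all the
  -- quantities below live; hence sup ∅ = 0 and inf ∅ = 1.

  UnitInterval : ℝ → Set
  UnitInterval x = 0# ≤ x × x ≤ 1#

  module _ {W : Set a} (P : Pred W b) (f : W → ℝ) where

    IsSup : ℝ → Set _
    IsSup v = UnitInterval v × (∀ {w} → P w → f w ≤ v) ×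
              (∀ {u} → UnitInterval u → (∀ {w} → P w → f w ≤ u) → v ≤ u)

    IsInf : ℝ → Set _
    IsInf v = UnitInterval v × (∀ {w} → P w → v ≤ f w) ×
              (∀ {u} → UnitInterval u → (∀ {w} → P w → u ≤ f w) → u ≤ v)

    sup inf : ℝ
    sup = the IsSup
    inf = the IsInf

  Hausdorff : {W : Set a} → (W → W → ℝ) → Pred W b → Pred W b → ℝ
  Hausdorff d P Q = sup P (λ x → inf Q (λ y → d x y))
                  ⊔ sup Q (λ y → inf P (λ x → d y x))

  record Dist (X : Set) : Set where
    field
      mass   : X → ℝ
      nonNeg : ∀ x → 0# ≤ mass x
      total  : IsSum mass 1#

  open Dist public

  infix 4 _∈supp_
  _∈supp_ : X → Dist X → Set
  x ∈supp π = 0# < mass π x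

  infix 4 _≈ᴰ_
  _≈ᴰ_ : Rel (Dist X) 0ℓ
  π ≈ᴰ π′ = ∀ x → mass π x ≈ mass π′ x

  -- Distributions are passed to the Kantorovich lifting as mass functions.

  IsCoupling : (X → ℝ) → (X → ℝ) → Dist (X × X) → Set
  IsCoupling p q ω = (∀ x → IsSum (λ y → mass ω (x , y)) (p x))
                   × (∀ y → IsSum (λ x → mass ω (x , y)) (q y))

  cost : (X → X → ℝ) → Dist (X × X) → ℝ
  cost d ω = ∑ (λ xy → mass ω xy * uncurry d xy)

  Kantorovich : (X → X → ℝ) → (X → ℝ) → (X → ℝ) → ℝ
  Kantorovich d p q = the λ v →
      (∃[ ω ] IsCoupling p q ω × cost d ω ≈ v)
    × (∀ ω → IsCoupling p q ω → v ≤ cost d ω)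

  discrete : X → X → ℝ
  discrete x y with lem {P = x ≡ y}
  ... | yes _ = 0#
  ... | no  _ = 1#

  record PTS (A : Set) : Set₁ where
    infix 4 _─[_]→_
    field
      State   : Set
      _─[_]→_ : State → A → Dist State → Set

    ImageFinite : Pred State 0ℓ
    ImageFinite s = ∀ a → ∃[ πs ] All (s ─[ a ]→_) πs ×
                    (∀ π → s ─[ a ]→ π → Any (π ≈ᴰ_) πs)

    Finite : Pred State 0ℓ
    Finite s = ¬ (Σ (ℕ → State) λ σ → σ 0 ≡ s ×
                  (∀ n → ∃₂ λ a π → (σ n ─[ a ]→ π) × σ (suc n) ∈supp π))

    data Computation (s : State) : Set where
      []   : Computation s
      step : ∀ {a π s′} → s ─[ a ]→ π → s′ ∈supp π → Computation s′ → Computation s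

    Pr : ∀ {s} → Computation s → ℝ
    Pr []                         = 1#
    Pr (step {π = π} {s′} _ _ c) = mass π s′ * Pr c

    tr : ∀ {s} → Computation s → List A
    tr []                   = []
    tr (step {a = a} _ _ c) = a ∷ tr c

    length : ∀ {s} → Computation s → ℕ
    length []           = 0
    length (step _ _ c) = suc (length c)

    -- Equality and proper prefix of computations compare actions, targets
    -- (as mass functions) and states, but not the proofs inside step.

    infix 4 _≋_ _⊏_

    data _≋_ {s} : Rel (Computation s) 0ℓ where
      []   : [] ≋ []
      step : ∀ {a π π′ s′} {t : s ─[ a ]→ π} {t′ : s ─[ a ]→ π′}
             {m : s′ ∈supp π} {m′ : s′ ∈supp π′} {c c′ : Computation s′} →
             π ≈ᴰ π′ → c ≋ c′ → step t m c ≋ step t′ m′ c′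

    data _⊏_ {s} : Rel (Computation s) 0ℓ where
      []   : ∀ {a π s′} {t : s ─[ a ]→ π} {m : s′ ∈supp π} {c : Computation s′} →
             [] ⊏ step t m c
      step : ∀ {a π π′ s′} {t : s ─[ a ]→ π} {t′ : s ─[ a ]→ π′}
             {m : s′ ∈supp π} {m′ : s′ ∈supp π′} {c c′ : Computation s′} →
             π ≈ᴰ π′ → c ⊏ c′ → step t m c ⊏ step t′ m′ c′

    Maximal : ∀ {s} → Pred (Computation s) 0ℓ
    Maximal c = ∀ c′ → ¬ (c ⊏ c′)

    -- The probability of a (finite) set of computations.
    PrSet : ∀ {s} → Pred (Computation s) 0ℓ → ℝ
    PrSet {s} C = the λ v → ∃[ cs ]
        AllPairs (λ c c′ → ¬ (c ≋ c′)) cs × All C cs ×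
        (∀ (c : Computation s) → C c → Any (c ≋_) cs) × sumList Pr cs ≈ v

    infix 4 _⊨ᶜ_
    data _⊨ᶜ_ {s} : Computation s → TraceFormula A → Set where
      ⊤    : ∀ {c} → c ⊨ᶜ ⊤
      ⟨_⟩_ : ∀ a {π s′ Φ} {t : s ─[ a ]→ π} {m : s′ ∈supp π} {c : Computation s′} →
             c ⊨ᶜ Φ → step t m c ⊨ᶜ ⟨ a ⟩ Φ

  -- ⊕_{i∈I} rᵢ Φᵢ with I = Fin (suc n)
  record TraceDistFormula (A : Set) : Set where
    field
      n        : ℕ
      r        : Fin (suc n) → ℝ
      Φ        : Fin (suc n) → TraceFormula A
      distinct : Injective _≡_ _≡_ Φ
      positive : ∀ i → 0# < r i
      atMost1  : ∀ i → r i ≤ 1#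
      total1   : sumFin r ≈ 1#

    weight : TraceFormula A → ℝ
    weight φ with lem {P = ∃[ i ] Φ i ≡ φ}
    ... | yes (i , _) = r i
    ... | no  _       = 0#

  D : TraceDistFormula A → TraceDistFormula A → ℝ
  D Ψ₁ Ψ₂ = Kantorovich discrete (weight Ψ₁) (weight Ψ₂)
    where open TraceDistFormula

  D-set : TraceDistFormula A → Pred (TraceDistFormula A) b → ℝ
  D-set Ψ L = inf L (D Ψ)

  module Process {A : Set} (P : PTS A) where

    open PTS P public

    record Resolution : Set₁ where
      field
        pts  : PTS A

      module Z = PTS pts

      field
        corr      : Z.State → State
        init      : Z.State
        init-root : ∀ {z a π} → z Z.─[ a ]→ π → ¬ (init ∈supp π)
        reached   : ∀ z → z ≢ init → ∃[ z′ ] ∃₂ λ a π →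
                    z′ ≢ z × (z′ Z.─[ a ]→ π) × z ∈supp π
        matched   : ∀ {z a π} → z Z.─[ a ]→ π → ∃[ π′ ]
                    (corr z ─[ a ]→ π′) × (∀ z′ → mass π z′ ≈ mass π′ (corr z′))
        atMostOne : ∀ {z a₁ a₂ π₁ π₂} → z Z.─[ a₁ ]→ π₁ → z Z.─[ a₂ ]→ π₂ →
                    a₁ ≡ a₂ × π₁ ≈ᴰ π₂

    res : State → Pred Resolution 0ℓ
    res s 𝓩 = Resolution.corr 𝓩 (Resolution.init 𝓩) ≡ s

    TD : Resolution → List A → ℝ
    TD 𝓩 α = Z.PrSet {init} (λ c → Z.Maximal c × Z.tr c ≡ α)
      where open Resolution 𝓩

    D-T : Resolution → Resolution → ℝ
    D-T 𝓩₁ 𝓩₂ = Kantorovich discrete (TD 𝓩₁) (TD 𝓩₂)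

    strongTraceMetric : State → State → ℝ
    strongTraceMetric s t = Hausdorff D-T (res s) (res t)

    infix 4 _⊨_
    _⊨_ : State → TraceDistFormula A → Set₁
    s ⊨ Ψ = ∃[ 𝓩 ] res s 𝓩 × let open Resolution 𝓩 in
            ∀ i → Z.PrSet {init} (λ c → Z.Maximal c × c Z.⊨ᶜ Φ i ×
                                        Z.length c ≡ depth (Φ i)) ≈ r i
      where open TraceDistFormula Ψ

    𝓛 : State → Pred (TraceDistFormula A) _
    𝓛 s Ψ = s ⊨ Ψ

    ⟦_⟧ : TraceDistFormula A → State → ℝ
    ⟦ Ψ ⟧ u = 1# - D-set Ψ (𝓛 u)

{-# OPTIONS --safe #-}

-- A resolution of a finite process has finitely many maximal computations
-- and their probabilities sum to 1, so its trace distribution is a finitely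
-- supported distribution, and the trace distribution formula with the same
-- weights is satisfied by the process; conversely, a satisfied formula has
-- the weights of the trace distribution of the witnessing resolution.  Hence
-- the strong trace metric is the Hausdorff distance of the sets of satisfied
-- formulae with respect to D.  D is the total variation distance, a
-- pseudometric with values in [0,1], and for every such d the Hausdorff
-- distance of two sets equals the supremum over all points x of the
-- difference of the distances of x from the two sets.

module Submission where

open import Algebra.Bundles using (CommutativeRing)
import Algebra.Construct.NaturalChoice.Max as NaturalMax
import Algebra.Construct.NaturalChoice.MaxOp as MaxOp
import Algebra.Construct.NaturalChoice.Min as NaturalMin
import Algebra.Construct.NaturalChoice.MinOp as MinOp
import Algebra.Properties.CommutativeSemigroup as CommutativeSemigroupProperties
import Algebra.Properties.Ring as RingProperties
open import Axiom.ExcludedMiddle using (ExcludedMiddle)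
open import Data.Empty using (⊥)
open import Data.Fin.Base using (Fin; zero; suc)
open import Data.List.Base as List using (List; []; _∷_; _++_; foldr; map; filter; lookup; tabulate; deduplicate;
  cartesianProduct)
open import Data.List.Membership.Propositional using (_∈_; _∉_; find; lose)
open import Data.List.Relation.Unary.All as All using (All; []; _∷_)
open import Data.List.Relation.Unary.AllPairs as AllPairs using (AllPairs; []; _∷_)
open import Data.List.Relation.Unary.Any as Any using (Any; here; there)
open import Data.List.Membership.Propositional.Properties
  using (∈-map⁺; ∈-++⁺ˡ; ∈-++⁺ʳ; ∈-cartesianProduct⁺; ∈-deduplicate⁺; ∈-filter⁺; ∈-tabulate⁺; ∈-lookup)
open import Data.List.Properties using (map-∘; tabulate-lookup; ∷-injectiveˡ; ∷-injectiveʳ)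
open import Data.List.Relation.Unary.Unique.Propositional using (Unique)
import Data.List.Relation.Unary.All.Properties as All
import Data.List.Relation.Unary.AllPairs.Properties as AllPairs
import Data.List.Relation.Unary.Any.Properties as Any
import Data.List.Relation.Unary.Unique.Propositional.Properties as Unique
open import Data.List.Relation.Unary.Unique.DecPropositional.Properties using (deduplicate-!)
open import Data.Nat.Base using (ℕ; zero; suc)
open import Data.Nat.Properties using (suc-injective)
open import Data.Product.Base using (∃; ∃₂; ∃-syntax; Σ-syntax; _×_; _,_; proj₁; proj₂; uncurry)
open import Data.Sum.Base using (_⊎_; inj₁; inj₂; [_,_]′)
open import Function.Base using (_∘_; id)
open import Function.Definitions using (Injective)
open import Induction.WellFounded using (Acc; acc)
open import Level using (Level; 0ℓ)
open import Relation.Binary.Bundles using (TotalOrder)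
open import Relation.Binary.Core using (Rel)
open import Relation.Binary.Definitions using (DecidableEquality; Symmetric; Transitive)
import Relation.Binary.PropositionalEquality.Core as ≡
open ≡ using (_≡_)
import Relation.Binary.Reasoning.PartialOrder as PartialOrderReasoning
open import Relation.Nullary.Decidable using (Dec; yes; no; True; toWitness; fromWitness; decidable-stable)
open import Relation.Nullary.Negation using (¬_; contradiction)
open import Relation.Unary using (Pred; U; _≐_)
open import Defs

-- The suprema, infima, coupling costs, minimal costs and probabilities are definite descriptions
-- with default value 0, so each of them can be used only after a witness has been exhibited and
-- shown to be unique. For the Kantorovich lifting the witness is explicit. Under the discrete
-- metric a coupling costs 1 minus its mass on the diagonal; that mass is at most the pointwise
-- minimum of the marginals, and one coupling attains this bound everywhere. The lifting thus
-- depends only on the sum of the pointwise minima, which reduces the pseudometric laws and the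
-- passage from traces to formulae to finite sums. The difference of the distances of a point from
-- two sets is bounded by the triangle inequality. The bound is approached at the points of the sets
-- themselves, where one of the two distances is 0.

trace : ∀ {A} → TraceFormula A → List A
trace ⊤         = []
trace (⟨ a ⟩ Φ) = a ∷ trace Φ

formula : ∀ {A} → List A → TraceFormula A
formula []      = ⊤
formula (a ∷ α) = ⟨ a ⟩ formula α

trace-formula : ∀ {A} (α : List A) → trace (formula α) ≡ α
trace-formula []      = ≡.refl
trace-formula (a ∷ α) = ≡.cong (a ∷_) (trace-formula α)

formula-trace : ∀ {A} (Φ : TraceFormula A) → formula (trace Φ) ≡ Φ
formula-trace ⊤         = ≡.refl
formula-trace (⟨ a ⟩ Φ) = ≡.cong ⟨ a ⟩_ (formula-trace Φ)

module Proof (lem : ∀ {ℓ} → ExcludedMiddle ℓ) (𝓡 : CompleteOrderedField) where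

  open Theory lem 𝓡 hiding (zero)
  open TotalOrder totalOrder using (poset; ≤-respˡ-≈; ≤-respʳ-≈)
    renaming (refl to ≤-refl; reflexive to ≤-reflexive; trans to ≤-trans; antisym to ≤-antisym; total to ≤-total)
  open NaturalMin totalOrder using (_⊓_; minOperator)
  open NaturalMax totalOrder using (maxOperator)
  open MinOp minOperator using (x⊓y≤x; x⊓y≤y; ⊓-glb; ⊓-comm; ⊓-cong; ⊓-idem)
  open MaxOp maxOperator using (x≤x⊔y; x≤y⊔x; ⊔-lub; ⊔-cong)
  open RingProperties (CommutativeRing.ring commutativeRing)
    using (-0#≈0#; -‿distribˡ-*; -‿involutive; \\-leftDividesʳ; ⁻¹-anti-homo‿-; x∙y⁻¹≈ε⇒x≈y;
      //-rightDividesˡ; //-rightDividesʳ)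
  open CommutativeSemigroupProperties (CommutativeRing.+-commutativeSemigroup commutativeRing)
    using (interchange)
  open PartialOrderReasoning poset

  private variable
    a b ℓ : Level
    X Y : Set
    x y z x′ y′ : ℝ

  -- Order and arithmetic

  minus-plus : ∀ x y → x - y + y ≈ x
  minus-plus x y = //-rightDividesˡ y x

  +-monoʳ-≤ : ∀ z {x y} → x ≤ y → z + x ≤ z + y
  +-monoʳ-≤ z {x} {y} x≤y = begin
    z + x ≈⟨ +-comm z x ⟩
    x + z ≤⟨ +-monoˡ-≤ z x≤y ⟩
    y + z ≈⟨ +-comm y z ⟩
    z + y ∎

  +-mono-≤ : x ≤ y → x′ ≤ y′ → x + x′ ≤ y + y′
  +-mono-≤ x≤y x′≤y′ = ≤-trans (+-monoˡ-≤ _ x≤y) (+-monoʳ-≤ _ x′≤y′)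

  +-cancelʳ-≤ : ∀ z → x + z ≤ y + z → x ≤ y
  +-cancelʳ-≤ {x} {y} z x+z≤y+z = begin
    x           ≈⟨ //-rightDividesʳ z x ⟨
    x + z - z   ≤⟨ +-monoˡ-≤ (- z) x+z≤y+z ⟩
    y + z - z   ≈⟨ //-rightDividesʳ z y ⟩
    y           ∎

  x≤y+z⇒x-z≤y : x ≤ y + z → x - z ≤ y
  x≤y+z⇒x-z≤y {z = z} h = +-cancelʳ-≤ z (≤-respˡ-≈ (sym (minus-plus _ z)) h)

  x-z≤y⇒x≤y+z : x - z ≤ y → x ≤ y + z
  x-z≤y⇒x≤y+z {z = z} h = ≤-respˡ-≈ (minus-plus _ z) (+-monoˡ-≤ z h)

  x≤x+y : 0# ≤ y → x ≤ x + y
  x≤x+y {y} {x} 0≤y = ≤-respˡ-≈ (+-identityʳ x) (+-monoʳ-≤ x 0≤y)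

  x≤y⇒0≤y-x : x ≤ y → 0# ≤ y - x
  x≤y⇒0≤y-x {x} {y} x≤y = +-cancelʳ-≤ x (begin
    0# + x    ≈⟨ +-identityˡ x ⟩
    x         ≤⟨ x≤y ⟩
    y         ≈⟨ minus-plus y x ⟨
    y - x + x ∎)

  neg-antimono-≤ : x ≤ y → - y ≤ - x
  neg-antimono-≤ {x} {y} x≤y = +-cancelʳ-≤ y (begin
    - y + y ≈⟨ -‿inverseˡ y ⟩
    0#      ≤⟨ x≤y⇒0≤y-x x≤y ⟩
    y - x   ≈⟨ +-comm y (- x) ⟩
    - x + y ∎)

  +-nonNeg : 0# ≤ x → 0# ≤ y → 0# ≤ x + y
  +-nonNeg 0≤x 0≤y = ≤-trans 0≤x (x≤x+y 0≤y)

  0≤1 : 0# ≤ 1#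
  0≤1 with ≤-total 0# 1#
  ... | inj₁ 0≤1 = 0≤1
  ... | inj₂ 1≤0 = begin
    0#            ≤⟨ *-nonNeg 0≤-1 0≤-1 ⟩
    - 1# * - 1#   ≈⟨ -‿distribˡ-* 1# (- 1#) ⟨
    - (1# * - 1#) ≈⟨ -‿cong (*-identityˡ (- 1#)) ⟩
    - - 1#        ≈⟨ -‿involutive 1# ⟩
    1#            ∎
    where
    0≤-1 : 0# ≤ - 1#
    0≤-1 = ≤-respˡ-≈ -0#≈0# (neg-antimono-≤ 1≤0)

  -- The difference of 1 and 0 is invertible, hence 1 is apart from 0, and apartness excludes
  -- equality.
  1≉0 : ¬ 1# ≈ 0#
  1≉0 1≈0 = #-irrefl 1≈0 (invertible⇒# (1# , 1[1-0]≈1 , trans (*-comm _ _) 1[1-0]≈1))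
    where
    1[1-0]≈1 : 1# * (1# - 0#) ≈ 1#
    1[1-0]≈1 = trans (*-identityˡ _) (trans (+-congˡ -0#≈0#) (+-identityʳ 1#))

  -- Only apartness from 0 gives an inverse. Tightness together with excluded middle derives it from
  -- inequality.
  nonZero-inverse : ¬ x ≈ 0# → ∃[ k ] k * x ≈ 1#
  nonZero-inverse {x} x≉0 with lem {P = x # 0#}
  ... | no ¬x#0 = contradiction (proj₁ (tight x 0#) ¬x#0) x≉0
  ... | yes x#0 with k , k[x-0]≈1 , _ ← #⇒invertible x#0 =
    k , trans (*-congˡ (sym (trans (+-congˡ -0#≈0#) (+-identityʳ x)))) k[x-0]≈1

  inverse-nonNeg : ∀ {k} → 0# ≤ x → k * x ≈ 1# → 0# ≤ k
  inverse-nonNeg {x} {k} 0≤x kx≈1 with ≤-total 0# k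
  ... | inj₁ 0≤k = 0≤k
  ... | inj₂ k≤0 = contradiction (≤-antisym 1≤0 0≤1) 1≉0
    where
    1≤0 : 1# ≤ 0#
    1≤0 = begin
      1#           ≈⟨ -‿involutive 1# ⟨
      - - 1#       ≈⟨ -‿cong (-‿cong kx≈1) ⟨
      - - (k * x)  ≈⟨ -‿cong (-‿distribˡ-* k x) ⟩
      - (- k * x)  ≤⟨ neg-antimono-≤ (*-nonNeg (≤-respˡ-≈ -0#≈0# (neg-antimono-≤ k≤0)) 0≤x) ⟩
      - 0#         ≈⟨ -0#≈0# ⟩
      0#           ∎

  -- Whichever of x and z is smaller, one minimum on the left is at most `x ⊓ z` and the other at
  -- most y.
  ⊓+⊓≤+⊓ : ∀ x y z → (x ⊓ y) + (y ⊓ z) ≤ y + (x ⊓ z)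
  ⊓+⊓≤+⊓ x y z = [ left , right ]′ (≤-total x z)
    where
    left : x ≤ z → (x ⊓ y) + (y ⊓ z) ≤ y + (x ⊓ z)
    left x≤z = begin
      (x ⊓ y) + (y ⊓ z) ≤⟨ +-mono-≤ (⊓-glb (x⊓y≤x x y) (≤-trans (x⊓y≤x x y) x≤z)) (x⊓y≤x y z) ⟩
      (x ⊓ z) + y       ≈⟨ +-comm (x ⊓ z) y ⟩
      y + (x ⊓ z)       ∎

    right : z ≤ x → (x ⊓ y) + (y ⊓ z) ≤ y + (x ⊓ z)
    right z≤x = +-mono-≤ (x⊓y≤y x y) (⊓-glb (≤-trans (x⊓y≤y y z) z≤x) (x⊓y≤y y z))

  -- This is the positive part of `x - y`.
  excess : ℝ → ℝ → ℝ
  excess x y = x - (x ⊓ y)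

  excess-nonNeg : ∀ x y → 0# ≤ excess x y
  excess-nonNeg x y = x≤y⇒0≤y-x (x⊓y≤x x y)

  x≤y⇒excess≈0 : x ≤ y → excess x y ≈ 0#
  x≤y⇒excess≈0 {x} {y} x≤y =
    trans (+-congˡ (-‿cong (≤-antisym (x⊓y≤x x y) (⊓-glb ≤-refl x≤y)))) (-‿inverseʳ x)

  -- One of the two positive parts is always 0. Therefore a product of the surpluses of two
  -- distributions puts no mass on the diagonal.
  excess*excess≈0 : ∀ x y → excess x y * excess y x ≈ 0#
  excess*excess≈0 x y =
    [ (λ x≤y → trans (*-congʳ (x≤y⇒excess≈0 x≤y)) (zeroˡ _))
    , (λ y≤x → trans (*-congˡ (x≤y⇒excess≈0 y≤x)) (zeroʳ _)) ]′ (≤-total x y)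

  -- Suprema and infima

  the-satisfies : {Q : ℝ → Set a} → ∃ Q → Q (the Q)
  the-satisfies {Q = Q} witness with lem {P = ∃ Q}
  ... | yes (_ , q) = q
  ... | no  ¬∃Q     = contradiction witness ¬∃Q

  the-unique : {Q : ℝ → Set a} → (∀ {x y} → Q x → Q y → x ≈ y) → Q x → the Q ≈ x
  the-unique {Q = Q} unique q = unique (the-satisfies {Q = Q} (_ , q)) q

  -- `complete` speaks about Set-valued predicates only; under excluded
  -- middle a predicate of any level is replaced by `True` of its decision.
  supremum : (Q : Pred ℝ a) → Q 0# → (∀ {x} → Q x → x ≤ 1#) →
             ∃[ v ] UnitInterval v × (∀ {x} → Q x → x ≤ v) ×
                    (∀ {u} → (∀ {x} → Q x → x ≤ u) → v ≤ u)
  supremum Q q₀ ≤1 with v , upper , least ← complete (λ x → True (lem {P = Q x}))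
      (0# , fromWitness q₀) (1# , ≤1 ∘ toWitness) =
    v , (upper (fromWitness q₀) , least (≤1 ∘ toWitness)) , upper ∘ fromWitness ,
    λ bound → least (bound ∘ toWitness)

  module _ {W : Set a} {P : Pred W b} {f : W → ℝ} where

    IsSup-unique : IsSup P f x → IsSup P f y → x ≈ y
    IsSup-unique (x∈I , x-upper , x-least) (y∈I , y-upper , y-least) =
      ≤-antisym (x-least y∈I y-upper) (y-least x∈I x-upper)

    IsInf-unique : IsInf P f x → IsInf P f y → x ≈ y
    IsInf-unique (x∈I , x-lower , x-greatest) (y∈I , y-lower , y-greatest) =
      ≤-antisym (y-greatest x∈I x-lower) (x-greatest y∈I y-lower)

    sup-isSup : (∀ {w} → P w → f w ≤ 1#) → IsSup P f (sup P f)
    sup-isSup f≤1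
      with v , v∈I , upper , least ← supremum
        -- The extra value 0 makes the set nonempty, as `complete` demands, and gives the supremum 0
        -- when P is empty.
        (λ x → x ≈ 0# ⊎ ∃[ w ] P w × f w ≈ x) (inj₁ refl)
        (λ { (inj₁ x≈0) → ≤-respˡ-≈ (sym x≈0) 0≤1 ; (inj₂ (_ , p , fw≈x)) → ≤-respˡ-≈ fw≈x (f≤1 p) }) =
      the-satisfies {Q = IsSup P f} (v , v∈I , (λ p → upper (inj₂ (_ , p , refl))) , λ (0≤u , _) bound → least
        λ { (inj₁ x≈0) → ≤-respˡ-≈ (sym x≈0) 0≤u ; (inj₂ (_ , p , fw≈x)) → ≤-respˡ-≈ fw≈x (bound p) })

    -- The infimum is the supremum of the lower bounds that lie in [0,1]. For empty P these fill the
    -- whole interval, which yields the value 1.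
    inf-isInf : (∀ {w} → P w → 0# ≤ f w) → IsInf P f (inf P f)
    inf-isInf 0≤f
      with v , v∈I , upper , least ← supremum
        (λ x → UnitInterval x × (∀ {w} → P w → x ≤ f w)) ((≤-refl , 0≤1) , 0≤f) (proj₂ ∘ proj₁) =
      the-satisfies {Q = IsInf P f} (v , v∈I , (λ p → least (λ (_ , bound) → bound p)) , λ u∈I bound → upper (u∈I , bound))

    -- An infimum is compared only with lower bounds in [0,1], and `x - e` may be negative. Its
    -- truncation `(x - e) ⊔ 0#` is a lower bound of the required kind.
    infimum-shift : ∀ {v e} → (∀ {w} → P w → 0# ≤ f w) → IsInf P f v → x ≤ 1# → 0# ≤ e →
                    (∀ {w} → P w → x ≤ f w + e) → x ≤ v + e
    infimum-shift {x} {v} {e} 0≤f (_ , _ , greatest) x≤1 0≤e bound =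
      x-z≤y⇒x≤y+z (≤-trans (x≤x⊔y (x - e) 0#) (greatest
        (x≤y⊔x (x - e) 0# , ⊔-lub (x≤y+z⇒x-z≤y (≤-trans x≤1 (x≤x+y 0≤e))) 0≤1)
        (λ p → ⊔-lub (x≤y+z⇒x-z≤y (bound p)) (0≤f p))))

  module _ {W : Set a} {W′ : Set b} {ℓ₁ ℓ₂} {P : Pred W ℓ₁} {P′ : Pred W′ ℓ₂} {f : W → ℝ} {f′ : W′ → ℝ}
           (to   : ∀ {w} → P w → ∃[ w′ ] P′ w′ × f w ≈ f′ w′)
           (from : ∀ {w′} → P′ w′ → ∃[ w ] P w × f w ≈ f′ w′) where

    sup-cong : (∀ {w} → P w → f w ≤ 1#) → sup P f ≈ sup P′ f′
    sup-cong f≤1 = sym (the-unique (IsSup-unique {P = P′} {f′}) (transfer (sup-isSup f≤1)))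
      where
      transfer : ∀ {v} → IsSup P f v → IsSup P′ f′ v
      transfer (v∈I , upper , least) = v∈I ,
        (λ p′ → let _ , p , eq = from p′ in ≤-respˡ-≈ eq (upper p)) ,
        (λ u∈I bound → least u∈I (λ p → let _ , p′ , eq = to p in ≤-respˡ-≈ (sym eq) (bound p′)))

    inf-cong : (∀ {w} → P w → 0# ≤ f w) → inf P f ≈ inf P′ f′
    inf-cong 0≤f = sym (the-unique (IsInf-unique {P = P′} {f′}) (transfer (inf-isInf 0≤f)))
      where
      transfer : ∀ {v} → IsInf P f v → IsInf P′ f′ v
      transfer (v∈I , lower , greatest) = v∈I ,
        (λ p′ → let _ , p , eq = from p′ in ≤-respʳ-≈ eq (lower p)) ,
        (λ u∈I bound → greatest u∈I (λ p → let _ , p′ , eq = to p in ≤-respʳ-≈ (sym eq) (bound p′)))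

  -- The Hausdorff distance

  module _ {W : Set a} {W′ : Set b} {ℓ₁ ℓ₂} {d : W → W → ℝ} {d′ : W′ → W′ → ℝ}
           {P Q : Pred W ℓ₁} {P′ Q′ : Pred W′ ℓ₂} (_≃_ : W → W′ → Set ℓ)
           (d≈d′ : ∀ {x x′ y y′} → x ≃ x′ → y ≃ y′ → d x y ≈ d′ x′ y′)
           (d-unit : ∀ {x x′ y y′} → x ≃ x′ → y ≃ y′ → UnitInterval (d x y))
           (P⇒P′ : ∀ {x} → P x → ∃[ x′ ] P′ x′ × x ≃ x′) (P′⇒P : ∀ {x′} → P′ x′ → ∃[ x ] P x × x ≃ x′)
           (Q⇒Q′ : ∀ {x} → Q x → ∃[ x′ ] Q′ x′ × x ≃ x′) (Q′⇒Q : ∀ {x′} → Q′ x′ → ∃[ x ] Q x × x ≃ x′)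
           where

    -- Every value on one side occurs on the other through a related point. The two carriers have
    -- separate levels because resolutions form a type in `Set₁` and formulae one in `Set`.
    Hausdorff-cong : Hausdorff d P Q ≈ Hausdorff d′ P′ Q′
    Hausdorff-cong = ⊔-cong (half P⇒P′ P′⇒P Q⇒Q′ Q′⇒Q) (half Q⇒Q′ Q′⇒Q P⇒P′ P′⇒P)
      where
      half : ∀ {P Q : Pred W ℓ₁} {P′ Q′ : Pred W′ ℓ₂} →
             (∀ {x} → P x → ∃[ x′ ] P′ x′ × x ≃ x′) → (∀ {x′} → P′ x′ → ∃[ x ] P x × x ≃ x′) →
             (∀ {x} → Q x → ∃[ x′ ] Q′ x′ × x ≃ x′) → (∀ {x′} → Q′ x′ → ∃[ x ] Q x × x ≃ x′) →
             sup P (λ x → inf Q (d x)) ≈ sup P′ (λ x′ → inf Q′ (d′ x′))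
      half {P} {Q} {P′} {Q′} P⇒P′ P′⇒P Q⇒Q′ Q′⇒Q = sup-cong
        (λ p → let x′ , p′ , x≃x′ = P⇒P′ p in x′ , p′ , inf≈inf x≃x′)
        (λ p′ → let x , p , x≃x′ = P′⇒P p′ in x , p , inf≈inf x≃x′)
        (λ p → let _ , _ , x≃x′ = P⇒P′ p in proj₂ (proj₁ (inf-isInf {P = Q} (0≤d x≃x′))))
        where
        0≤d : ∀ {x x′} → x ≃ x′ → ∀ {y} → Q y → 0# ≤ d x y
        0≤d x≃x′ q = let _ , _ , y≃y′ = Q⇒Q′ q in proj₁ (d-unit x≃x′ y≃y′)

        inf≈inf : ∀ {x x′} → x ≃ x′ → inf Q (d x) ≈ inf Q′ (d′ x′)
        inf≈inf x≃x′ = inf-cong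
          (λ q → let y′ , q′ , y≃y′ = Q⇒Q′ q in y′ , q′ , d≈d′ x≃x′ y≃y′)
          (λ q′ → let y , q , y≃y′ = Q′⇒Q q′ in y , q , d≈d′ x≃x′ y≃y′)
          (0≤d x≃x′)

  module _ {W : Set a} {d : W → W → ℝ}
           (d-unit : ∀ x y → UnitInterval (d x y)) (d-self : ∀ x → d x x ≈ 0#)
           (d-triangle : ∀ x y z → d x z ≤ d x y + d y z) where

    private
      infDist : Pred W b → W → ℝ
      infDist P x = inf P (d x)

      infDist-isInf : (P : Pred W b) → ∀ x → IsInf P (d x) (infDist P x)
      infDist-isInf P x = inf-isInf {P = P} (λ _ → proj₁ (d-unit x _))

      infDist-unit : (P : Pred W b) → ∀ x → UnitInterval (infDist P x)
      infDist-unit P x = proj₁ (infDist-isInf P x)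

      infDist-member : (P : Pred W b) → ∀ {x} → P x → infDist P x ≈ 0#
      infDist-member P {x} p = ≤-antisym
        (≤-respʳ-≈ (d-self x) (proj₁ (proj₂ (infDist-isInf P x)) p)) (proj₁ (infDist-unit P x))

      deviation-isSup : (P Q : Pred W b) → IsSup P (infDist Q) (sup P (infDist Q))
      deviation-isSup P Q = sup-isSup {P = P} (λ _ → proj₂ (infDist-unit Q _))

      infDist-lipschitz : (P : Pred W b) → ∀ x y → infDist P x ≤ infDist P y + d x y
      infDist-lipschitz P x y = infimum-shift {P = P} (λ _ → proj₁ (d-unit y _)) (infDist-isInf P y)
        (proj₂ (infDist-unit P x)) (proj₁ (d-unit x y))
        (λ {w} p → ≤-trans (proj₁ (proj₂ (infDist-isInf P x)) p)
                     (≤-respʳ-≈ (+-comm _ _) (d-triangle x y w)))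

      -- Any w in P satisfies `infDist Q x ≤ infDist Q w + d x w`, and `infDist Q w` is at most the
      -- deviation. It remains to take the infimum over w.
      infDist-deviation : (P Q : Pred W b) → ∀ x → infDist Q x ≤ infDist P x + sup P (infDist Q)
      infDist-deviation P Q x = infimum-shift {P = P} (λ _ → proj₁ (d-unit x _)) (infDist-isInf P x)
        (proj₂ (infDist-unit Q x)) (proj₁ (proj₁ (deviation-isSup P Q)))
        (λ {w} p → ≤-trans (infDist-lipschitz Q x w)
                     (≤-respʳ-≈ (+-comm _ _) (+-monoˡ-≤ _ (proj₁ (proj₂ (deviation-isSup P Q)) p))))

      complement-difference : ∀ p q → (1# - p) - (1# - q) ≈ q - p
      complement-difference p q = begin-equality
        (1# - p) - (1# - q)  ≈⟨ +-congˡ (⁻¹-anti-homo‿- 1# q) ⟩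
        (1# - p) + (q - 1#)  ≈⟨ +-comm (1# - p) (q - 1#) ⟩
        (q - 1#) + (1# - p)  ≈⟨ +-assoc q (- 1#) (1# - p) ⟩
        q + (- 1# + (1# - p)) ≈⟨ +-congˡ (\\-leftDividesʳ 1# (- p)) ⟩
        q - p                ∎

    -- At a point of P the distance from P vanishes, so the gap there is at least the distance from
    -- Q, and likewise with the sets exchanged. Conversely, `infDist-deviation`, applied in both
    -- directions, bounds the gap at every point.
    Hausdorff≈sup-∣-∣ : (P Q : Pred W b) →
      Hausdorff d P Q ≈ sup U (λ x → ∣ (1# - inf P (d x)) - (1# - inf Q (d x)) ∣)
    Hausdorff≈sup-∣-∣ P Q = ≤-antisym
      (⊔-lub (proj₂ (proj₂ (deviation-isSup P Q)) unit lower₁)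
             (proj₂ (proj₂ (deviation-isSup Q P)) unit lower₂))
      (proj₂ (proj₂ gap-isSup)
        ( ≤-trans (proj₁ (proj₁ (deviation-isSup P Q))) (x≤x⊔y _ _)
        , ⊔-lub (proj₂ (proj₁ (deviation-isSup P Q))) (proj₂ (proj₁ (deviation-isSup Q P))))
        (λ {x} _ → gap≤ (≤-trans (deviation P Q x) (x≤x⊔y _ _)) (≤-trans (deviation Q P x) (x≤y⊔x _ _))))
      where
      gap : W → ℝ
      gap x = ∣ (1# - infDist P x) - (1# - infDist Q x) ∣

      gap≤ : ∀ {x v} → infDist Q x - infDist P x ≤ v → infDist P x - infDist Q x ≤ v → gap x ≤ v
      gap≤ Q-P≤v P-Q≤v = ⊔-lub (≤-respˡ-≈ (sym (complement-difference _ _)) Q-P≤v)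
        (≤-respˡ-≈ (sym (trans (⁻¹-anti-homo‿- _ _) (complement-difference _ _))) P-Q≤v)

      difference≤1 : ∀ {p q} → UnitInterval p → UnitInterval q → q - p ≤ 1#
      difference≤1 (0≤p , _) (_ , q≤1) = x≤y+z⇒x-z≤y (≤-trans q≤1 (x≤x+y 0≤p))

      gap-isSup : IsSup U gap (sup U gap)
      gap-isSup = sup-isSup {P = U} (λ {x} _ → gap≤ (difference≤1 (infDist-unit P x) (infDist-unit Q x))
                                                    (difference≤1 (infDist-unit Q x) (infDist-unit P x)))

      unit : UnitInterval (sup U gap)
      unit = proj₁ gap-isSup

      deviation : (P Q : Pred W _) → ∀ x → infDist Q x - infDist P x ≤ sup P (infDist Q)
      deviation P Q x = x≤y+z⇒x-z≤y (≤-respʳ-≈ (+-comm _ _) (infDist-deviation P Q x))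

      subtract-zero : ∀ {p q} → p ≈ 0# → q - p ≈ q
      subtract-zero p≈0 = trans (+-congˡ (trans (-‿cong p≈0) -0#≈0#)) (+-identityʳ _)

      lower₁ : ∀ {x} → P x → infDist Q x ≤ sup U gap
      lower₁ {x} p = begin
        infDist Q x                               ≈⟨ subtract-zero (infDist-member P p) ⟨
        infDist Q x - infDist P x                 ≈⟨ complement-difference _ _ ⟨
        (1# - infDist P x) - (1# - infDist Q x)   ≤⟨ x≤x⊔y _ _ ⟩
        gap x                                     ≤⟨ proj₁ (proj₂ gap-isSup) _ ⟩
        sup U gap                                 ∎

      lower₂ : ∀ {x} → Q x → infDist P x ≤ sup U gap
      lower₂ {x} q = begin
        infDist P x                                 ≈⟨ subtract-zero (infDist-member Q q) ⟨
        infDist P x - infDist Q x                   ≈⟨ complement-difference _ _ ⟨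
        (1# - infDist Q x) - (1# - infDist P x)     ≈⟨ ⁻¹-anti-homo‿- _ _ ⟨
        - ((1# - infDist P x) - (1# - infDist Q x)) ≤⟨ x≤y⊔x _ _ ⟩
        gap x                                       ≤⟨ proj₁ (proj₂ gap-isSup) _ ⟩
        sup U gap                                   ∎

  -- Finite sums

  indicator : Set a → ℝ
  indicator B with lem {P = B}
  ... | yes _ = 1#
  ... | no  _ = 0#

  indicator-yes : {B : Set a} → B → indicator B ≈ 1#
  indicator-yes {B = B} holds with lem {P = B}
  ... | yes _     = refl
  ... | no  fails = contradiction holds fails

  indicator-no : {B : Set a} → ¬ B → indicator B ≈ 0#
  indicator-no {B = B} fails with lem {P = B}
  ... | yes holds = contradiction holds fails
  ... | no  _     = refl

  indicator-nonNeg : (B : Set a) → 0# ≤ indicator B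
  indicator-nonNeg B with lem {P = B}
  ... | yes _ = 0≤1
  ... | no  _ = ≤-refl

  indicator-*-cong : {B : Set a} {C : Set b} → (B → C) → (C → B) → (B → x ≈ y) →
                     indicator B * x ≈ indicator C * y
  indicator-*-cong {B = B} {C} B⇒C C⇒B x≈y with lem {P = B} | lem {P = C}
  ... | yes holds | yes _     = *-congˡ (x≈y holds)
  ... | yes holds | no  fails = contradiction (B⇒C holds) fails
  ... | no  fails | yes holds = contradiction (C⇒B holds) fails
  ... | no  _     | no  _     = trans (zeroˡ _) (sym (zeroˡ _))

  sumList-cong : ∀ {f g : X → ℝ} xs → (∀ {x} → x ∈ xs → f x ≈ g x) → sumList f xs ≈ sumList g xs
  sumList-cong []       f≈g = refl
  sumList-cong (x ∷ xs) f≈g = +-cong (f≈g (here ≡.refl)) (sumList-cong xs (f≈g ∘ there))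

  sumList-mono : ∀ {f g : X → ℝ} xs → (∀ {x} → x ∈ xs → f x ≤ g x) → sumList f xs ≤ sumList g xs
  sumList-mono []       f≤g = ≤-refl
  sumList-mono (x ∷ xs) f≤g = +-mono-≤ (f≤g (here ≡.refl)) (sumList-mono xs (f≤g ∘ there))

  sumList-zero : ∀ {f : X → ℝ} xs → (∀ {x} → x ∈ xs → f x ≈ 0#) → sumList f xs ≈ 0#
  sumList-zero []       f≈0 = refl
  sumList-zero (x ∷ xs) f≈0 = trans (+-cong (f≈0 (here ≡.refl)) (sumList-zero xs (f≈0 ∘ there))) (+-identityˡ 0#)

  sumList-nonNeg : ∀ {f : X → ℝ} xs → (∀ {x} → x ∈ xs → 0# ≤ f x) → 0# ≤ sumList f xs
  sumList-nonNeg []       0≤f = ≤-refl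
  sumList-nonNeg (x ∷ xs) 0≤f = +-nonNeg (0≤f (here ≡.refl)) (sumList-nonNeg xs (0≤f ∘ there))

  sumList-+ : ∀ (f g : X → ℝ) xs → sumList (λ x → f x + g x) xs ≈ sumList f xs + sumList g xs
  sumList-+ f g []       = sym (+-identityˡ 0#)
  sumList-+ f g (x ∷ xs) = trans (+-congˡ (sumList-+ f g xs)) (interchange _ _ _ _)

  sumList-*ˡ : ∀ k (f : X → ℝ) xs → sumList (λ x → k * f x) xs ≈ k * sumList f xs
  sumList-*ˡ k f []       = sym (zeroʳ k)
  sumList-*ˡ k f (x ∷ xs) = trans (+-congˡ (sumList-*ˡ k f xs)) (sym (distribˡ k _ _))

  sumList-*ʳ : ∀ k (f : X → ℝ) xs → sumList (λ x → f x * k) xs ≈ sumList f xs * k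
  sumList-*ʳ k f xs = trans (sumList-cong xs (λ _ → *-comm _ k)) (trans (sumList-*ˡ k f xs) (*-comm k _))

  sumList-++ : ∀ (f : X → ℝ) xs ys → sumList f (xs ++ ys) ≈ sumList f xs + sumList f ys
  sumList-++ f []       ys = sym (+-identityˡ _)
  sumList-++ f (x ∷ xs) ys = trans (+-congˡ (sumList-++ f xs ys)) (sym (+-assoc _ _ _))

  sumList-map : ∀ (f : Y → ℝ) (g : X → Y) xs → sumList f (map g xs) ≈ sumList (f ∘ g) xs
  sumList-map f g xs = reflexive (≡.cong (foldr _+_ 0#) (≡.sym (map-∘ xs)))

  sumList-swap : ∀ (f : X → Y → ℝ) xs ys →
    sumList (λ x → sumList (f x) ys) xs ≈ sumList (λ y → sumList (λ x → f x y) xs) ys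
  sumList-swap f []       ys = sym (sumList-zero ys (λ _ → refl))
  sumList-swap f (x ∷ xs) ys = trans (+-congˡ (sumList-swap f xs ys)) (sym (sumList-+ (f x) _ ys))

  sumList-cartesianProduct : ∀ (f : X × Y → ℝ) xs ys →
    sumList f (cartesianProduct xs ys) ≈ sumList (λ x → sumList (λ y → f (x , y)) ys) xs
  sumList-cartesianProduct f []       ys = refl
  sumList-cartesianProduct f (x ∷ xs) ys = trans (sumList-++ f (map (x ,_) ys) _)
    (+-cong (sumList-map f (x ,_) ys) (sumList-cartesianProduct f xs ys))

  sumList-filter : ∀ {C : Pred X a} (f : X → ℝ) xs →
    sumList f (filter (λ x → lem {P = C x}) xs) ≈ sumList (λ x → indicator (C x) * f x) xs
  sumList-filter         f []       = refl
  sumList-filter {C = C} f (x ∷ xs) with lem {P = C x}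
  ... | yes _ = +-cong (sym (*-identityˡ _)) (sumList-filter f xs)
  ... | no  _ = trans (sumList-filter f xs) (sym (trans (+-congʳ (zeroˡ _)) (+-identityˡ _)))

  ∈⇒≤sumList : ∀ {f : X → ℝ} {x} xs → (∀ x → 0# ≤ f x) → x ∈ xs → f x ≤ sumList f xs
  ∈⇒≤sumList (x ∷ xs) 0≤f (here ≡.refl) = x≤x+y (sumList-nonNeg xs (λ _ → 0≤f _))
  ∈⇒≤sumList (x ∷ xs) 0≤f (there x∈xs)  = ≤-trans (∈⇒≤sumList xs 0≤f x∈xs)
    (≤-respʳ-≈ (+-comm _ _) (x≤x+y (0≤f x)))

  sumList≈0⇒≈0 : ∀ {f : X → ℝ} {x} xs → (∀ x → 0# ≤ f x) → sumList f xs ≈ 0# → x ∈ xs → f x ≈ 0#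
  sumList≈0⇒≈0 xs 0≤f eq x∈xs = ≤-antisym (≤-respʳ-≈ eq (∈⇒≤sumList xs 0≤f x∈xs)) (0≤f _)

  module _ {_∼_ : Rel X ℓ} (∼-sym : Symmetric _∼_) (∼-trans : Transitive _∼_) where

    -- Two entries related to x would be related to each other, so exactly one term survives. The
    -- relation is a parameter because supports are compared by `_≡_` and computations by `_≋_`.
    sumList-indicator : ∀ {x} w {ys} → AllPairs (λ y y′ → ¬ y ∼ y′) ys → Any (x ∼_) ys →
                        sumList (λ y → indicator (x ∼ y) * w) ys ≈ w
    sumList-indicator w {y ∷ ys} (y≁ys ∷ _) (here x∼y) = trans
      (+-cong (trans (*-congʳ (indicator-yes x∼y)) (*-identityˡ w))
        (sumList-zero ys (λ y′∈ys → trans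
          (*-congʳ (indicator-no (λ x∼y′ → All.lookup y≁ys y′∈ys (∼-trans (∼-sym x∼y) x∼y′)))) (zeroˡ w))))
      (+-identityʳ w)
    sumList-indicator w {y ∷ ys} (y≁ys ∷ ys-distinct) (there x∼ys) = trans
      (+-cong (trans (*-congʳ (indicator-no λ x∼y →
          All.All¬⇒¬Any y≁ys (Any.map (∼-trans (∼-sym x∼y)) x∼ys))) (zeroˡ w))
        (sumList-indicator w ys-distinct x∼ys))
      (+-identityˡ w)

    -- Both sides equal the double sum of [x ∼ y] f x over xs × ys.
    sumList-unique : ∀ {f : X → ℝ} {xs ys} → (∀ {x y} → x ∼ y → f x ≈ f y) →
      AllPairs (λ x x′ → ¬ x ∼ x′) xs → AllPairs (λ y y′ → ¬ y ∼ y′) ys →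
      (∀ {x} → x ∈ xs → f x ≈ 0# ⊎ Any (x ∼_) ys) → (∀ {y} → y ∈ ys → f y ≈ 0# ⊎ Any (y ∼_) xs) →
      sumList f xs ≈ sumList f ys
    sumList-unique {f} {xs} {ys} f-resp xs-distinct ys-distinct xs-covered ys-covered = begin-equality
      sumList f xs
        ≈⟨ sumList-cong xs (λ x∈xs → spread ys-distinct (xs-covered x∈xs)) ⟨
      sumList (λ x → sumList (λ y → indicator (x ∼ y) * f x) ys) xs
        ≈⟨ sumList-swap _ xs ys ⟩
      sumList (λ y → sumList (λ x → indicator (x ∼ y) * f x) xs) ys
        ≈⟨ sumList-cong ys (λ _ → sumList-cong xs λ _ → indicator-*-cong ∼-sym ∼-sym f-resp) ⟩
      sumList (λ y → sumList (λ x → indicator (y ∼ x) * f y) xs) ys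
        ≈⟨ sumList-cong ys (λ y∈ys → spread xs-distinct (ys-covered y∈ys)) ⟩
      sumList f ys ∎
      where
      spread : ∀ {x zs} → AllPairs (λ z z′ → ¬ z ∼ z′) zs → f x ≈ 0# ⊎ Any (x ∼_) zs →
               sumList (λ z → indicator (x ∼ z) * f x) zs ≈ f x
      spread {zs = zs} _ (inj₁ fx≈0) = trans (sumList-zero zs (λ _ → trans (*-congˡ fx≈0) (zeroʳ _))) (sym fx≈0)
      spread zs-distinct (inj₂ x∼zs) = sumList-indicator _ zs-distinct x∼zs

  -- The list inside `IsSum` is arbitrary and may differ from zs, but an entry that only one of the
  -- lists contains has value 0.
  IsSum-over : ∀ {f : X → ℝ} {v zs} → Unique zs → (∀ {x} → x ∉ zs → f x ≈ 0#) → IsSum f v →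
               sumList f zs ≈ v
  IsSum-over {f = f} {zs = zs} zs! f≈0 (xs , xs! , f≈0′ , eq) = trans
    (sumList-unique ≡.sym ≡.trans (reflexive ∘ ≡.cong f) zs! xs! (λ _ → cover xs f≈0′) (λ _ → cover zs f≈0)) eq
    where
    cover : ∀ {x} ys → (∀ {x} → x ∉ ys → f x ≈ 0#) → f x ≈ 0# ⊎ x ∈ ys
    cover {x} ys f≈0 with lem {P = x ∈ ys}
    ... | yes x∈ys = inj₂ x∈ys
    ... | no  x∉ys = inj₁ (f≈0 x∉ys)

  IsSum-unique : ∀ {f : X → ℝ} → IsSum f x → IsSum f y → x ≈ y
  IsSum-unique (xs , xs! , f≈0 , eq) sum-y = trans (sym eq) (IsSum-over xs! f≈0 sum-y)

  ∑-unique : ∀ {f : X → ℝ} {v} → IsSum f v → ∑ f ≈ v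
  ∑-unique = the-unique IsSum-unique

  IsSum-cong : ∀ {f g : X → ℝ} {v w} → (∀ x → f x ≈ g x) → v ≈ w → IsSum f v → IsSum g w
  IsSum-cong f≈g v≈w (xs , xs! , f≈0 , eq) = xs , xs! , (λ x∉xs → trans (sym (f≈g _)) (f≈0 x∉xs)) ,
    trans (sumList-cong xs (λ _ → sym (f≈g _))) (trans eq v≈w)

  IsSum-∘ : ∀ {f : X → ℝ} {v} {h : Y → X} {h⁻¹ : X → Y} → (∀ x → h (h⁻¹ x) ≡ x) → (∀ y → h⁻¹ (h y) ≡ y) →
            IsSum f v → IsSum (f ∘ h) v
  IsSum-∘ {f = f} {h = h} {h⁻¹} h∘h⁻¹ h⁻¹∘h (xs , xs! , f≈0 , eq) =
    map h⁻¹ xs ,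
    Unique.map⁺ (λ {x} {y} h⁻¹x≡h⁻¹y → ≡.trans (≡.sym (h∘h⁻¹ x)) (≡.trans (≡.cong h h⁻¹x≡h⁻¹y) (h∘h⁻¹ y))) xs! ,
    (λ {y} y∉ → f≈0 (λ hy∈xs → y∉ (≡.subst (_∈ map h⁻¹ xs) (h⁻¹∘h y) (∈-map⁺ h⁻¹ hy∈xs)))) ,
    trans (sumList-map (f ∘ h) h⁻¹ xs) (trans (sumList-cong xs (λ {x} _ → reflexive (≡.cong f (h∘h⁻¹ x)))) eq)

  module _ {f : X → ℝ} (0≤f : ∀ x → 0# ≤ f x) where

    IsSum≈0⇒≈0 : ∀ {v} → IsSum f v → v ≈ 0# → ∀ x → f x ≈ 0#
    IsSum≈0⇒≈0 (xs , _ , f≈0 , eq) v≈0 x with lem {P = x ∈ xs}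
    ... | yes x∈xs = sumList≈0⇒≈0 xs 0≤f (trans eq v≈0) x∈xs
    ... | no  x∉xs = f≈0 x∉xs

    term≤IsSum : ∀ {v} → IsSum f v → ∀ x → f x ≤ v
    term≤IsSum (xs , _ , f≈0 , eq) x with lem {P = x ∈ xs}
    ... | yes x∈xs = ≤-respʳ-≈ eq (∈⇒≤sumList xs 0≤f x∈xs)
    ... | no  x∉xs = ≤-respˡ-≈ (sym (f≈0 x∉xs)) (≤-respʳ-≈ eq (sumList-nonNeg xs (λ _ → 0≤f _)))

  sumList-indicator-≡ : ∀ {x : X} w {ys} → Unique ys → (x ∉ ys → w ≈ 0#) →
                        sumList (λ y → indicator (x ≡ y) * w) ys ≈ w
  sumList-indicator-≡ {x = x} w {ys} ys! w≈0 with lem {P = x ∈ ys}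
  ... | yes x∈ys = sumList-indicator ≡.sym ≡.trans w ys! x∈ys
  ... | no  x∉ys = trans (sumList-zero ys (λ _ → trans (*-congˡ (w≈0 x∉ys)) (zeroʳ _))) (sym (w≈0 x∉ys))

  discrete-split : (x y : X) → ∀ w → w * discrete x y + indicator (x ≡ y) * w ≈ w
  discrete-split x y w with lem {P = x ≡ y}
  ... | yes _ = trans (+-cong (zeroʳ w) (*-identityˡ w)) (+-identityˡ w)
  ... | no  _ = trans (+-cong (*-identityʳ w) (zeroˡ w)) (+-identityʳ w)

  x+y≈z⇒x≈z-y : x + y ≈ z → x ≈ z - y
  x+y≈z⇒x≈z-y {x} {y} eq = trans (sym (//-rightDividesʳ y x)) (+-congʳ eq)

  -- The Kantorovich lifting of the discrete metric

  Supported : Dist X → List X → Set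
  Supported p zs = ∀ {x} → x ∉ zs → mass p x ≈ 0#

  -- Sums are compared termwise over one list, and the triangle inequality involves three
  -- distributions; hence a support common to a whole list of them.
  joint-support : (ps : List (Dist X)) → ∃[ zs ] Unique zs × All (λ p → Supported p zs) ps
  joint-support {X = X} ps = deduplicate _≟_ (supports ps) , deduplicate-! _≟_ (supports ps) ,
    All.map (λ p≈0 {x} x∉ → p≈0 (x∉ ∘ ∈-deduplicate⁺ _≟_)) (supported ps)
    where
    _≟_ : DecidableEquality X
    x ≟ y = lem

    supports : List (Dist X) → List X
    supports []       = []
    supports (p ∷ ps) = proj₁ (total p) ++ supports ps

    supported : ∀ ps → All (λ p → Supported p (supports ps)) ps
    supported []       = []
    supported (p ∷ ps) = (λ x∉ → proj₁ (proj₂ (proj₂ (total p))) (x∉ ∘ ∈-++⁺ˡ)) ∷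
      All.map (λ p≈0 {x} x∉ → p≈0 (x∉ ∘ ∈-++⁺ʳ (proj₁ (total p)))) (supported ps)

  common : Dist X → Dist X → X → ℝ
  common p q x = mass p x ⊓ mass q x

  surplus : Dist X → Dist X → X → ℝ
  surplus p q x = excess (mass p x) (mass q x)

  common-nonNeg : (p q : Dist X) → ∀ x → 0# ≤ common p q x
  common-nonNeg p q x = ⊓-glb (nonNeg p x) (nonNeg q x)

  mass≈0⇒common≈0 : (p q : Dist X) → ∀ {x} → mass p x ≈ 0# → common p q x ≈ 0#
  mass≈0⇒common≈0 p q p≈0 = ≤-antisym (≤-respʳ-≈ p≈0 (x⊓y≤x _ _)) (common-nonNeg p q _)

  mass≈0⇒surplus≈0 : (p q : Dist X) → ∀ {x} → mass p x ≈ 0# → surplus p q x ≈ 0#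
  mass≈0⇒surplus≈0 p q p≈0 = x≤y⇒excess≈0 (≤-respˡ-≈ (sym p≈0) (nonNeg q _))

  sumList-surplus : (p q : Dist X) → ∀ {zs} → Unique zs → Supported p zs →
                    sumList (surplus p q) zs ≈ 1# - sumList (common p q) zs
  sumList-surplus p q {zs} zs! p≈0 = x+y≈z⇒x≈z-y (begin-equality
    sumList (surplus p q) zs + sumList (common p q) zs ≈⟨ sumList-+ _ _ zs ⟨
    sumList (λ x → surplus p q x + common p q x) zs    ≈⟨ sumList-cong zs (λ _ → minus-plus _ _) ⟩
    sumList (mass p) zs                                 ≈⟨ IsSum-over zs! p≈0 (total p) ⟩
    1#                                                  ∎)

  module _ (p q : Dist X) {zs : List X} (zs! : Unique zs) (p≈0 : Supported p zs) (q≈0 : Supported q zs) where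

    vanishes-off-product : ∀ {f : X × X → ℝ} → (∀ {x y} → x ∉ zs → f (x , y) ≈ 0#) →
      (∀ {x y} → y ∉ zs → f (x , y) ≈ 0#) → ∀ {xy} → xy ∉ cartesianProduct zs zs → f xy ≈ 0#
    vanishes-off-product off-row off-column {x , y} xy∉ with lem {P = x ∈ zs} | lem {P = y ∈ zs}
    ... | no  x∉zs | _        = off-row x∉zs
    ... | yes _    | no  y∉zs = off-column y∉zs
    ... | yes x∈zs | yes y∈zs = contradiction (∈-cartesianProduct⁺ x∈zs y∈zs) xy∉

    -- The cost of a row and its diagonal entry add up to the whole row, hence to `mass p x`, and
    -- the rows together have mass 1. The marginals confine ω to the square of zs.
    cost-isSum : ∀ ω → IsCoupling (mass p) (mass q) ω →
      IsSum (λ xy → mass ω xy * uncurry discrete xy) (1# - sumList (λ x → mass ω (x , x)) zs)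
    cost-isSum ω (rows , columns) =
      cartesianProduct zs zs , Unique.cartesianProduct⁺ zs! zs! ,
      vanishes-off-product (λ {x} {y} x∉zs → trans (*-congʳ (off-row x∉zs)) (zeroˡ (discrete x y)))
                           (λ {x} {y} y∉zs → trans (*-congʳ (off-column y∉zs)) (zeroˡ (discrete x y))) ,
      trans (sumList-cartesianProduct _ zs zs) (x+y≈z⇒x≈z-y (begin-equality
        sumList row-cost zs + sumList (λ x → mass ω (x , x)) zs ≈⟨ sumList-+ _ _ zs ⟨
        sumList (λ x → row-cost x + mass ω (x , x)) zs          ≈⟨ sumList-cong zs (λ _ → row-split _) ⟩
        sumList (mass p) zs                                     ≈⟨ IsSum-over zs! p≈0 (total p) ⟩
        1#                                                      ∎))
      where
      off-row : ∀ {x y} → x ∉ zs → mass ω (x , y) ≈ 0#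
      off-row x∉zs = IsSum≈0⇒≈0 (λ _ → nonNeg ω _) (rows _) (p≈0 x∉zs) _

      off-column : ∀ {x y} → y ∉ zs → mass ω (x , y) ≈ 0#
      off-column y∉zs = IsSum≈0⇒≈0 (λ _ → nonNeg ω _) (columns _) (q≈0 y∉zs) _

      row-cost : X → ℝ
      row-cost x = sumList (λ y → mass ω (x , y) * discrete x y) zs

      row-split : ∀ x → row-cost x + mass ω (x , x) ≈ mass p x
      row-split x = begin-equality
        row-cost x + mass ω (x , x)
          ≈⟨ +-congˡ (sumList-indicator-≡ _ zs! off-row) ⟨
        row-cost x + sumList (λ y → indicator (x ≡ y) * mass ω (x , x)) zs
          ≈⟨ sumList-+ _ _ zs ⟨
        sumList (λ y → mass ω (x , y) * discrete x y + indicator (x ≡ y) * mass ω (x , x)) zs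
          ≈⟨ sumList-cong zs (λ {y} _ → trans
               (+-congˡ (indicator-*-cong id id (λ x≡y → reflexive (≡.cong (λ z → mass ω (x , z)) x≡y))))
               (discrete-split x y _)) ⟩
        sumList (λ y → mass ω (x , y)) zs
          ≈⟨ IsSum-over zs! off-column (rows x) ⟩
        mass p x ∎

    -- The entry at (x , x) belongs both to a row with sum `mass p x` and to a column with sum
    -- `mass q x`.
    diagonal≤common : ∀ ω → IsCoupling (mass p) (mass q) ω → ∀ x → mass ω (x , x) ≤ common p q x
    diagonal≤common ω (rows , columns) x = ⊓-glb
      (term≤IsSum (λ _ → nonNeg ω _) (rows x) x) (term≤IsSum (λ _ → nonNeg ω _) (columns x) x)

  -- For T = 0 the inverse 1/T is replaced by 0.
  normaliser : ∀ {T} → 0# ≤ T → ∃[ k ] 0# ≤ k × (∀ {x} → (T ≈ 0# → x ≈ 0#) → x * (T * k) ≈ x)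
  normaliser {T} 0≤T with lem {P = T ≈ 0#}
  ... | yes T≈0 = 0# , ≤-refl , λ x≈0 → trans (*-congʳ (x≈0 T≈0)) (trans (zeroˡ _) (sym (x≈0 T≈0)))
  ... | no  T≉0 with k , kT≈1 ← nonZero-inverse T≉0 =
    k , inverse-nonNeg 0≤T kT≈1 , λ _ → trans (*-congˡ (trans (*-comm T k) kT≈1)) (*-identityʳ _)

  -- The common mass stays on the diagonal; the surplus of p is moved to the
  -- surplus of q by the product coupling, normalised by k.
  optimal : Dist X → Dist X → ℝ → X → X → ℝ
  optimal p q k x y = indicator (x ≡ y) * common p q x + surplus p q x * (surplus q p y * k)

  module _ (p q : Dist X) (k : ℝ) where

    optimal-nonNeg : 0# ≤ k → ∀ x y → 0# ≤ optimal p q k x y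
    optimal-nonNeg 0≤k x y = +-nonNeg (*-nonNeg (indicator-nonNeg _) (common-nonNeg p q x))
      (*-nonNeg (excess-nonNeg _ _) (*-nonNeg (excess-nonNeg _ _) 0≤k))

    -- This lets the columns for p and q be read as rows for q and p, so that `optimal-row` yields
    -- both marginals.
    optimal-swap : ∀ x y → optimal q p k y x ≈ optimal p q k x y
    optimal-swap x y = +-cong
      (indicator-*-cong ≡.sym ≡.sym (λ { ≡.refl → ⊓-comm _ _ }))
      (trans (sym (*-assoc _ _ _)) (trans (*-congʳ (*-comm _ _)) (*-assoc _ _ _)))

    optimal-diagonal : ∀ x → optimal p q k x x ≈ common p q x
    optimal-diagonal x = trans (+-cong
      (trans (*-congʳ (indicator-yes ≡.refl)) (*-identityˡ _))
      (trans (sym (*-assoc _ _ _)) (trans (*-congʳ (excess*excess≈0 _ _)) (zeroˡ k)))) (+-identityʳ _)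

    module _ {zs : List X} (zs! : Unique zs) (p≈0 : Supported p zs) (q≈0 : Supported q zs)
             {T : ℝ} (k-normalises : ∀ {x} → (T ≈ 0# → x ≈ 0#) → x * (T * k) ≈ x)
             (p-surplus : sumList (surplus p q) zs ≈ T) (q-surplus : sumList (surplus q p) zs ≈ T) where

      -- If T is 0, the surpluses are nonnegative with sum 0, so both sides vanish and the
      -- replacement for 1/T is harmless.
      surplus-normalised : ∀ x → surplus p q x * (T * k) ≈ surplus p q x
      surplus-normalised x = k-normalises λ T≈0 →
        IsSum≈0⇒≈0 (λ _ → excess-nonNeg _ _) (zs , zs! , mass≈0⇒surplus≈0 p q ∘ p≈0 , p-surplus) T≈0 x

      optimal-row : ∀ x → IsSum (optimal p q k x) (mass p x)
      optimal-row x = zs , zs! ,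
        (λ y∉zs → trans (+-cong
          (trans (indicator-*-cong id id (λ { ≡.refl → mass≈0⇒common≈0 p q (p≈0 y∉zs) })) (zeroʳ _))
          (trans (*-congˡ (trans (*-congʳ (mass≈0⇒surplus≈0 q p (q≈0 y∉zs))) (zeroˡ k))) (zeroʳ _)))
          (+-identityʳ 0#)) ,
        (begin-equality
          sumList (optimal p q k x) zs
            ≈⟨ sumList-+ _ _ zs ⟩
          sumList (λ y → indicator (x ≡ y) * common p q x) zs + sumList (λ y → surplus p q x * (surplus q p y * k)) zs
            ≈⟨ +-cong (sumList-indicator-≡ _ zs! (mass≈0⇒common≈0 p q ∘ p≈0))
                      (trans (sumList-*ˡ _ _ zs) (*-congˡ (trans (sumList-*ʳ k _ zs) (*-congʳ q-surplus)))) ⟩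
          common p q x + surplus p q x * (T * k)
            ≈⟨ +-congˡ (surplus-normalised x) ⟩
          common p q x + surplus p q x
            ≈⟨ +-comm _ _ ⟩
          surplus p q x + common p q x
            ≈⟨ minus-plus _ _ ⟩
          mass p x ∎)

  module _ (p q : Dist X) {zs : List X} (zs! : Unique zs) (p≈0 : Supported p zs) (q≈0 : Supported q zs) where

    optimal-coupling : ∃[ ω ] IsCoupling (mass p) (mass q) ω × (∀ x → mass ω (x , x) ≈ common p q x)
    optimal-coupling
      with k , 0≤k , k-normalises ← normaliser (sumList-nonNeg {f = surplus p q} zs (λ _ → excess-nonNeg _ _)) =
      ω , (rows , columns) , optimal-diagonal p q k
      where
      -- Both totals are 1 minus the common mass, which is symmetric in p and q. Hence the single
      -- constant `k` normalises rows and columns alike.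
      surpluses-agree : sumList (surplus q p) zs ≈ sumList (surplus p q) zs
      surpluses-agree = trans (sumList-surplus q p zs! q≈0)
        (trans (+-congˡ (-‿cong (sumList-cong zs (λ _ → ⊓-comm _ _)))) (sym (sumList-surplus p q zs! p≈0)))

      rows : ∀ x → IsSum (optimal p q k x) (mass p x)
      rows = optimal-row p q k zs! p≈0 q≈0 k-normalises refl surpluses-agree

      columns : ∀ y → IsSum (λ x → optimal p q k x y) (mass q y)
      columns y = IsSum-cong (λ x → optimal-swap p q k x y) refl
        (optimal-row q p k zs! q≈0 p≈0 k-normalises surpluses-agree refl y)

      ω : Dist (_ × _)
      ω = record
        { mass   = λ (x , y) → optimal p q k x y
        ; nonNeg = λ (x , y) → optimal-nonNeg p q k 0≤k x y
        ; total  = cartesianProduct zs zs , Unique.cartesianProduct⁺ zs! zs! ,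
            vanishes-off-product p q zs! p≈0 q≈0
              (λ {x} {y} x∉zs → IsSum≈0⇒≈0 (optimal-nonNeg p q k 0≤k x) (rows x) (p≈0 x∉zs) y)
              (λ {x} {y} y∉zs → IsSum≈0⇒≈0 (λ x → optimal-nonNeg p q k 0≤k x y) (columns y) (q≈0 y∉zs) x) ,
            trans (sumList-cartesianProduct _ zs zs)
              (trans (sumList-cong zs (λ {x} _ → IsSum-over zs! (off-column x) (rows x)))
                     (IsSum-over zs! p≈0 (total p)))
        }
        where
        off-column : ∀ x {y} → y ∉ zs → optimal p q k x y ≈ 0#
        off-column x {y} y∉zs = IsSum≈0⇒≈0 (λ x → optimal-nonNeg p q k 0≤k x y) (columns y) (q≈0 y∉zs) x

    -- A coupling is cheapest when its diagonal is heaviest. `diagonal≤common` caps every diagonal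
    -- entry, and `optimal-coupling` meets all the caps at once.
    Kantorovich-over : Kantorovich discrete (mass p) (mass q) ≈ 1# - sumList (common p q) zs
    Kantorovich-over with ω , coupling , diagonal ← optimal-coupling = the-unique
      (λ { ((ω₁ , coupling₁ , eq₁) , least₁) ((ω₂ , coupling₂ , eq₂) , least₂) →
           ≤-antisym (≤-respʳ-≈ eq₂ (least₁ ω₂ coupling₂)) (≤-respʳ-≈ eq₁ (least₂ ω₁ coupling₁)) })
      ( (ω , coupling , trans (cost-value ω coupling) (+-congˡ (-‿cong (sumList-cong zs (λ _ → diagonal _)))))
      , λ ω′ coupling′ → ≤-respʳ-≈ (sym (cost-value ω′ coupling′))
          (+-monoʳ-≤ 1# (neg-antimono-≤ (sumList-mono zs (λ {x} _ → diagonal≤common p q zs! p≈0 q≈0 ω′ coupling′ x)))))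
      where
      cost-value : ∀ ω → IsCoupling (mass p) (mass q) ω → cost discrete ω ≈ 1# - sumList (λ x → mass ω (x , x)) zs
      cost-value ω coupling = ∑-unique (cost-isSum p q zs! p≈0 q≈0 ω coupling)

  common-isSum : (p q : Dist X) → ∃[ v ] IsSum (common p q) v
  common-isSum p q with zs , zs! , p≈0 ∷ q≈0 ∷ [] ← joint-support (p ∷ q ∷ []) =
    sumList (common p q) zs , zs , zs! , mass≈0⇒common≈0 p q ∘ p≈0 , refl

  Kantorovich-discrete : (p q : Dist X) → ∀ {v} → IsSum (common p q) v →
                         Kantorovich discrete (mass p) (mass q) ≈ 1# - v
  Kantorovich-discrete p q sum-v with zs , zs! , p≈0 ∷ q≈0 ∷ [] ← joint-support (p ∷ q ∷ []) =
    trans (Kantorovich-over p q zs! p≈0 q≈0)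
      (+-congˡ (-‿cong (IsSum-over zs! (mass≈0⇒common≈0 p q ∘ p≈0) sum-v)))

  Kantorovich-unit : (p q : Dist X) → UnitInterval (Kantorovich discrete (mass p) (mass q))
  Kantorovich-unit p q with zs , zs! , p≈0 ∷ q≈0 ∷ [] ← joint-support (p ∷ q ∷ []) =
    ≤-respʳ-≈ (sym K≈) (x≤y⇒0≤y-x (≤-respʳ-≈ (IsSum-over zs! p≈0 (total p)) (sumList-mono zs (λ _ → x⊓y≤x _ _)))) ,
    ≤-respˡ-≈ (sym K≈) (x≤y+z⇒x-z≤y (x≤x+y (sumList-nonNeg zs (λ _ → common-nonNeg p q _))))
    where
    K≈ : Kantorovich discrete (mass p) (mass q) ≈ 1# - sumList (common p q) zs
    K≈ = Kantorovich-over p q zs! p≈0 q≈0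

  Kantorovich-self : (p : Dist X) → Kantorovich discrete (mass p) (mass p) ≈ 0#
  Kantorovich-self p = trans
    (Kantorovich-discrete p p (IsSum-cong (λ _ → sym (⊓-idem _)) refl (total p))) (-‿inverseʳ 1#)

  -- In terms of common masses the claim reads `pq + qr ≤ 1# + pr`. This is `⊓+⊓≤+⊓` summed over the
  -- support, where the masses of q contribute the 1.
  Kantorovich-triangle : (p q r : Dist X) →
    Kantorovich discrete (mass p) (mass r) ≤
    Kantorovich discrete (mass p) (mass q) + Kantorovich discrete (mass q) (mass r)
  Kantorovich-triangle p q r
    with zs , zs! , p≈0 ∷ q≈0 ∷ r≈0 ∷ [] ← joint-support (p ∷ q ∷ r ∷ []) = begin
    Kantorovich discrete (mass p) (mass r)
      ≈⟨ Kantorovich-over p r zs! p≈0 r≈0 ⟩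
    1# - pr
      ≤⟨ x≤y+z⇒x-z≤y (+-cancelʳ-≤ (pq + qr) (begin
           1# + (pq + qr)                             ≤⟨ +-monoʳ-≤ 1# pq+qr≤1+pr ⟩
           1# + (1# + pr)                             ≈⟨ +-assoc 1# 1# pr ⟨
           (1# + 1#) + pr                             ≈⟨ +-congʳ (+-cong (minus-plus 1# pq) (minus-plus 1# qr)) ⟨
           ((1# - pq + pq) + (1# - qr + qr)) + pr     ≈⟨ +-congʳ (interchange _ _ _ _) ⟩
           ((1# - pq) + (1# - qr) + (pq + qr)) + pr   ≈⟨ +-assoc _ _ _ ⟩
           (1# - pq) + (1# - qr) + ((pq + qr) + pr)   ≈⟨ +-congˡ (+-comm _ _) ⟩
           (1# - pq) + (1# - qr) + (pr + (pq + qr))   ≈⟨ +-assoc _ _ _ ⟨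
           (1# - pq) + (1# - qr) + pr + (pq + qr)     ∎)) ⟩
    (1# - pq) + (1# - qr)
      ≈⟨ +-cong (Kantorovich-over p q zs! p≈0 q≈0) (Kantorovich-over q r zs! q≈0 r≈0) ⟨
    Kantorovich discrete (mass p) (mass q) + Kantorovich discrete (mass q) (mass r) ∎
    where
    pq pr qr : ℝ
    pq = sumList (common p q) zs
    pr = sumList (common p r) zs
    qr = sumList (common q r) zs

    pq+qr≤1+pr : pq + qr ≤ 1# + pr
    pq+qr≤1+pr = begin
      pq + qr                                      ≈⟨ sumList-+ _ _ zs ⟨
      sumList (λ x → common p q x + common q r x) zs ≤⟨ sumList-mono zs (λ _ → ⊓+⊓≤+⊓ _ _ _) ⟩
      sumList (λ x → mass q x + common p r x) zs   ≈⟨ sumList-+ _ _ zs ⟩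
      sumList (mass q) zs + pr                     ≈⟨ +-congʳ (IsSum-over zs! q≈0 (total q)) ⟩
      1# + pr                                      ∎

  -- Both sides are determined by the sum of the common masses, which the
  -- bijection h preserves.
  Kantorovich-∘ : (p q : Dist X) (p′ q′ : Dist Y) {h : Y → X} {h⁻¹ : X → Y} →
    (∀ x → h (h⁻¹ x) ≡ x) → (∀ y → h⁻¹ (h y) ≡ y) →
    (∀ y → mass p′ y ≈ mass p (h y)) → (∀ y → mass q′ y ≈ mass q (h y)) →
    Kantorovich discrete (mass p′) (mass q′) ≈ Kantorovich discrete (mass p) (mass q)
  Kantorovich-∘ p q p′ q′ h∘h⁻¹ h⁻¹∘h p′≈p q′≈q with v , sum-v ← common-isSum p q = trans
    (Kantorovich-discrete p′ q′
      (IsSum-cong (λ y → sym (⊓-cong (p′≈p y) (q′≈q y))) refl (IsSum-∘ h∘h⁻¹ h⁻¹∘h sum-v)))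
    (sym (Kantorovich-discrete p q sum-v))

  -- The differences are nonnegative and their sum is 1 minus 1.
  mass-≤⇒≈ : (p q : Dist X) → (∀ x → mass p x ≤ mass q x) → p ≈ᴰ q
  mass-≤⇒≈ p q p≤q x with zs , zs! , p≈0 ∷ q≈0 ∷ [] ← joint-support (p ∷ q ∷ []) =
    sym (x∙y⁻¹≈ε⇒x≈y _ _ (IsSum≈0⇒≈0 (λ x → x≤y⇒0≤y-x (p≤q x))
      (zs , zs! , (λ x∉zs → trans (+-cong (q≈0 x∉zs) (trans (-‿cong (p≈0 x∉zs)) -0#≈0#)) (+-identityˡ 0#)) , refl)
      (begin-equality
        sumList (λ x → mass q x - mass p x) zs
          ≈⟨ x+y≈z⇒x≈z-y (trans (sym (sumList-+ _ _ zs)) (sumList-cong zs (λ _ → minus-plus _ _))) ⟩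
        sumList (mass q) zs - sumList (mass p) zs
          ≈⟨ +-cong (IsSum-over zs! q≈0 (total q)) (-‿cong (IsSum-over zs! p≈0 (total p))) ⟩
        1# - 1#
          ≈⟨ -‿inverseʳ 1# ⟩
        0# ∎) x))

  ¬0<⇒≈0 : 0# ≤ x → ¬ 0# < x → x ≈ 0#
  ¬0<⇒≈0 {x} 0≤x ¬0<x with lem {P = 0# ≈ x}
  ... | yes 0≈x = sym 0≈x
  ... | no  0≉x = contradiction (0≤x , 0≉x) ¬0<x

  -- Maximal computations of a deterministic, finite process

  module Computations {A : Set} (𝓟 : PTS A) where

    open PTS 𝓟

    infix 4 _≺_
    _≺_ : Rel State 0ℓ
    z′ ≺ z = ∃₂ λ a π → (z ─[ a ]→ π) × z′ ∈supp π

    -- By excluded middle a state that is not accessible has a successor that is not accessible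
    -- either. Iterating this produces an infinite path, which finiteness forbids.
    Finite⇒Acc : ∀ {z} → Finite z → Acc _≺_ z
    Finite⇒Acc {z} finite with lem {P = Acc _≺_ z}
    ... | yes z-acc  = z-acc
    ... | no  z-¬acc = contradiction (proj₁ ∘ path , ≡.refl , λ n → proj₂ (descend (path n))) finite
      where
      descend : ((w , _) : ∃[ w ] ¬ Acc _≺_ w) → Σ[ (w′ , _) ∈ (∃[ w ] ¬ Acc _≺_ w) ] w′ ≺ w
      descend (w , w-¬acc) with lem {P = ∃[ w′ ] w′ ≺ w × ¬ Acc _≺_ w′}
      ... | yes (w′ , w′≺w , w′-¬acc) = (w′ , w′-¬acc) , w′≺w
      ... | no  none = contradiction (acc (λ {w′} w′≺w →
        decidable-stable lem (λ w′-¬acc → none (w′ , w′≺w , w′-¬acc)))) w-¬acc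

      path : ℕ → ∃[ w ] ¬ Acc _≺_ w
      path zero    = z , z-¬acc
      path (suc n) = proj₁ (descend (path n))

    ≋-sym : ∀ {z} → Symmetric (_≋_ {z})
    ≋-sym []               = []
    ≋-sym (step π≈π′ c≋c′) = step (λ x → sym (π≈π′ x)) (≋-sym c≋c′)

    ≋-trans : ∀ {z} → Transitive (_≋_ {z})
    ≋-trans []               []                 = []
    ≋-trans (step π≈π′ c≋c′) (step π′≈π″ c′≋c″) = step (λ x → trans (π≈π′ x) (π′≈π″ x)) (≋-trans c≋c′ c′≋c″)

    Pr-resp : ∀ {z} {c c′ : Computation z} → c ≋ c′ → Pr c ≈ Pr c′
    Pr-resp []               = refl
    Pr-resp (step π≈π′ c≋c′) = *-cong (π≈π′ _) (Pr-resp c≋c′)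

    tr-resp : ∀ {z} {c c′ : Computation z} → c ≋ c′ → tr c ≡ tr c′
    tr-resp []            = ≡.refl
    tr-resp (step _ c≋c′) = ≡.cong (_ ∷_) (tr-resp c≋c′)

    Pr-nonNeg : ∀ {z} (c : Computation z) → 0# ≤ Pr c
    Pr-nonNeg []                      = 0≤1
    Pr-nonNeg (step {π = π} {s′} _ _ c) = *-nonNeg (nonNeg π s′) (Pr-nonNeg c)

    IsPrSet : ∀ {z} → Pred (Computation z) 0ℓ → ℝ → Set
    IsPrSet {z} C v = ∃[ cs ] AllPairs (λ c c′ → ¬ (c ≋ c′)) cs × All C cs ×
                      (∀ (c : Computation z) → C c → Any (c ≋_) cs) × sumList Pr cs ≈ v

    PrSet-unique : ∀ {z} {C : Pred (Computation z) 0ℓ} {v} → IsPrSet C v → PrSet C ≈ v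
    PrSet-unique {C = C} = the-unique {Q = IsPrSet C} unique
      where
      unique : IsPrSet C x → IsPrSet C y → x ≈ y
      unique (cs , cs! , C-cs , cover , eq) (cs′ , cs′! , C-cs′ , cover′ , eq′) = trans (sym eq) (trans
        (sumList-unique ≋-sym ≋-trans Pr-resp cs! cs′!
          (λ c∈cs → inj₂ (cover′ _ (All.lookup C-cs c∈cs))) (λ c∈cs′ → inj₂ (cover _ (All.lookup C-cs′ c∈cs′)))) eq′)

    IsPrSet-cong : ∀ {z} {C C′ : Pred (Computation z) 0ℓ} {v} → C ≐ C′ → IsPrSet C v → IsPrSet C′ v
    IsPrSet-cong (C⊆C′ , C′⊆C) (cs , cs! , C-cs , cover , eq) =
      cs , cs! , All.map C⊆C′ C-cs , (λ c → cover c ∘ C′⊆C) , eq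

    -- A witness is kept instead of an equation about `PrSet`, because filtering its list by trace
    -- enumerates the computations behind each value of the trace distribution.
    MaximalEnumeration : State → Set
    MaximalEnumeration z = IsPrSet (Maximal {z}) 1#

    IsPrSet-tr : ∀ {z} ((cs , _) : MaximalEnumeration z) → ∀ α →
      IsPrSet (λ c → Maximal c × tr c ≡ α) (sumList (λ c → indicator (tr c ≡ α) * Pr c) cs)
    IsPrSet-tr (cs , cs! , maximal , cover , _) α =
      filter tr≟α cs , AllPairs.filter⁺ tr≟α cs! ,
      All.zip (All.filter⁺ tr≟α maximal , All.all-filter tr≟α cs) ,
      (λ c (c-maximal , tr≡α) → let c′ , c′∈cs , c≋c′ = find (cover c c-maximal) in
        lose (∈-filter⁺ tr≟α c′∈cs (≡.trans (≡.sym (tr-resp c≋c′)) tr≡α)) c≋c′) ,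
      sumList-filter Pr cs
      where
      tr≟α : ∀ c → Dec (tr c ≡ α)
      tr≟α c = lem

    PrSet-tr : ∀ {z} ((cs , _) : MaximalEnumeration z) → ∀ α →
      PrSet {z} (λ c → Maximal c × tr c ≡ α) ≈ sumList (λ c → indicator (tr c ≡ α) * Pr c) cs
    PrSet-tr enumeration α = PrSet-unique (IsPrSet-tr enumeration α)

    traceDist : ∀ {z} → MaximalEnumeration z → Dist (List A)
    traceDist {z} enumeration@(cs , _ , _ , _ , eq) = record
      { mass   = λ α → PrSet {z} (λ c → Maximal c × tr c ≡ α)
      ; nonNeg = λ α → ≤-respʳ-≈ (sym (PrSet-tr enumeration α))
                   (sumList-nonNeg cs (λ {c} _ → *-nonNeg (indicator-nonNeg _) (Pr-nonNeg c)))
      ; total  = αs , deduplicate-! _≟_ _ ,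
          (λ {α} α∉ → trans (PrSet-tr enumeration α) (sumList-zero cs (λ c∈cs → trans
            (*-congʳ (indicator-no (λ { ≡.refl → α∉ (tr∈αs c∈cs) }))) (zeroˡ _)))) ,
          (begin-equality
            sumList (λ α → PrSet {z} (λ c → Maximal c × tr c ≡ α)) αs
              ≈⟨ sumList-cong αs (λ {α} _ → PrSet-tr enumeration α) ⟩
            sumList (λ α → sumList (λ c → indicator (tr c ≡ α) * Pr c) cs) αs
              -- Each computation has exactly one trace, so after the exchange it is counted once.
              ≈⟨ sumList-swap _ αs cs ⟩
            sumList (λ c → sumList (λ α → indicator (tr c ≡ α) * Pr c) αs) cs
              ≈⟨ sumList-cong cs (λ c∈cs →
                   sumList-indicator-≡ _ (deduplicate-! _≟_ _) (contradiction (tr∈αs c∈cs))) ⟩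
            sumList Pr cs
              ≈⟨ eq ⟩
            1# ∎)
      }
      where
      _≟_ : DecidableEquality (List A)
      α ≟ β = lem

      αs : List (List A)
      αs = deduplicate _≟_ (map tr cs)

      tr∈αs : ∀ {c} → c ∈ cs → tr c ∈ αs
      tr∈αs c∈cs = ∈-deduplicate⁺ _≟_ (∈-map⁺ tr c∈cs)

    module _ (deterministic : ∀ {z a₁ a₂ π₁ π₂} → z ─[ a₁ ]→ π₁ → z ─[ a₂ ]→ π₂ → a₁ ≡ a₂ × π₁ ≈ᴰ π₂) where

      -- Restricting the state reached by the first step permits an induction on the list that
      -- supports the first target.
      Enters : ∀ {z} → List State → Pred (Computation z) 0ℓ
      Enters xs []                      = ⊥
      Enters xs (step {s′ = s′} _ _ _) = s′ ∈ xs

      module _ {z a π} (t : z ─[ a ]→ π) (rec : ∀ {z′} → z′ ∈supp π → MaximalEnumeration z′) where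

        step-maximal : ∀ {z′} {m : z′ ∈supp π} {c} → Maximal c → Maximal (step t m c)
        step-maximal c-maximal _ (step _ c⊏c′) = c-maximal _ c⊏c′

        -- Computations with different first states are never equal, so each x adds a separate
        -- block: `t` followed by the maximal computations from x, of total probability
        -- `mass π x * 1#`. An x outside the support of π adds neither computations nor mass.
        enumerateEntering : ∀ {xs} → Unique xs →
          IsPrSet {z} (λ c → Maximal c × Enters xs c) (sumList (mass π) xs)
        enumerateEntering {[]} [] = [] , [] , [] , (λ { [] (_ , ()) ; (step _ _ _) (_ , ()) }) , refl
        enumerateEntering {x ∷ xs} (x∉xs ∷ xs!) with enumerateEntering xs! | lem {P = x ∈supp π}
        ... | ds , ds! , entering , cover , eq | no x∉π =
          ds , ds! , All.map (λ { {step _ _ _} (maximal , into) → maximal , there into }) entering , cover′ ,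
          trans eq (trans (sym (+-identityˡ _)) (+-congʳ (sym (¬0<⇒≈0 (nonNeg π x) x∉π))))
          where
          cover′ : ∀ c → Maximal c × Enters (x ∷ xs) c → Any (c ≋_) ds
          -- The transition `t′` need not be `t`, but determinism gives their targets equal masses,
          -- so x would lie in the support of π.
          cover′ (step t′ m′ c) (_ , here ≡.refl) = contradiction
            (≤-respʳ-≈ (proj₂ (deterministic t′ t) _) (proj₁ m′) ,
             λ 0≈π → proj₂ m′ (trans 0≈π (sym (proj₂ (deterministic t′ t) _)))) x∉π
          cover′ c@(step _ _ _) (maximal , there into) = cover c (maximal , into)
        ... | ds , ds! , entering , cover , eq | yes m with cs , cs! , maximal , cs-cover , cs-eq ← rec m =
          map (step t m) cs ++ ds ,
          AllPairs.++⁺ (AllPairs.map⁺ (AllPairs.map (λ { c≋̸c′ (step _ c≋c′) → c≋̸c′ c≋c′ }) cs!)) ds!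
            (All.map⁺ (All.tabulate λ _ → All.map
              (λ { (_ , into) (step _ _) → All.lookup x∉xs into ≡.refl }) entering)) ,
          All.++⁺ (All.map⁺ (All.map (λ c-maximal → step-maximal c-maximal , here ≡.refl) maximal))
            (All.map (λ { {step _ _ _} (d-maximal , into) → d-maximal , there into }) entering) ,
          cover′ ,
          (begin-equality
            sumList Pr (map (step t m) cs ++ ds)          ≈⟨ sumList-++ Pr (map (step t m) cs) ds ⟩
            sumList Pr (map (step t m) cs) + sumList Pr ds ≈⟨ +-cong (sumList-map Pr (step t m) cs) eq ⟩
            sumList (λ c → mass π x * Pr c) cs + sumList (mass π) xs
              ≈⟨ +-congʳ (trans (sumList-*ˡ _ Pr cs) (trans (*-congˡ cs-eq) (*-identityʳ _))) ⟩
            mass π x + sumList (mass π) xs ∎)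
          where
          cover′ : ∀ c → Maximal c × Enters (x ∷ xs) c → Any (c ≋_) (map (step t m) cs ++ ds)
          cover′ (step t′ m′ c) (c-maximal , here ≡.refl) with deterministic t′ t
          ... | ≡.refl , π′≈π = Any.++⁺ˡ (Any.map⁺ (Any.map (step π′≈π)
            (cs-cover c (λ c′ c⊏c′ → c-maximal (step t′ m′ c′) (step (λ _ → refl) c⊏c′)))))
          cover′ c@(step _ _ _) (c-maximal , there into) = Any.++⁺ʳ _ (cover c (c-maximal , into))

        enumerate-step : MaximalEnumeration z
        enumerate-step
          with xs , xs! , π≈0 , eq ← total π
          with cs , cs! , entering , cover , cs-eq ← enumerateEntering xs! =
          cs , cs! , All.map proj₁ entering ,
          (λ c c-maximal → cover c (c-maximal , enters c c-maximal)) , trans cs-eq eq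
          where
          enters : ∀ c → Maximal c → Enters xs c
          -- If the empty computation were maximal, no state could be entered, and all masses of π
          -- would be 0 although they sum to 1.
          enters [] []-maximal = contradiction (trans (sym eq) (sumList-zero xs (λ {x} _ →
            ¬0<⇒≈0 (nonNeg π x) (λ m → []-maximal (step t m []) [])))) 1≉0
          enters (step {s′ = s′} t′ m′ _) _ = decidable-stable lem (λ s′∉xs →
            proj₂ m′ (sym (trans (proj₂ (deterministic t′ t) s′) (π≈0 s′∉xs))))

      enumerate : ∀ {z} → Acc _≺_ z → MaximalEnumeration z
      enumerate {z} (acc rs) with lem {P = ∃₂ λ a π → z ─[ a ]→ π}
      ... | yes (a , π , t) = enumerate-step t (λ m → enumerate (rs (a , π , t , m)))
      ... | no  stuck = [] ∷ [] , [] ∷ [] , (λ { _ ([] {t = t}) → stuck (_ , _ , t) }) ∷ [] ,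
        (λ { [] _ → here [] ; (step t _ _) _ → contradiction (_ , _ , t) stuck }) , +-identityʳ 1#

    -- Satisfaction alone says that `trace Φ` is a prefix of the trace of c, because `⊤` accepts any
    -- continuation. The length condition rules out a proper continuation.
    ⊨ᶜ⇒tr≡trace : ∀ {z Φ} {c : Computation z} → c ⊨ᶜ Φ → length c ≡ depth Φ → tr c ≡ trace Φ
    ⊨ᶜ⇒tr≡trace {c = []} ⊤ _ = ≡.refl
    ⊨ᶜ⇒tr≡trace (⟨ a ⟩ c⊨Φ) eq = ≡.cong (a ∷_) (⊨ᶜ⇒tr≡trace c⊨Φ (suc-injective eq))

    tr≡trace⇒⊨ᶜ : ∀ {z} Φ {c : Computation z} → tr c ≡ trace Φ → c ⊨ᶜ Φ × length c ≡ depth Φ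
    tr≡trace⇒⊨ᶜ ⊤ {[]} _ = ⊤ , ≡.refl
    tr≡trace⇒⊨ᶜ (⟨ a ⟩ Φ) {step _ _ c} eq with ≡.refl ← ∷-injectiveˡ eq =
      let c⊨Φ , |c|≡ = tr≡trace⇒⊨ᶜ Φ (∷-injectiveʳ eq) in ⟨ a ⟩ c⊨Φ , ≡.cong suc |c|≡

    PrSet-⊨ᶜ : ∀ {z} → MaximalEnumeration z → ∀ Φ →
      PrSet {z} (λ c → Maximal c × c ⊨ᶜ Φ × length c ≡ depth Φ) ≈ PrSet {z} (λ c → Maximal c × tr c ≡ trace Φ)
    PrSet-⊨ᶜ enumeration Φ = trans
      (PrSet-unique (IsPrSet-cong
        ( (λ (maximal , eq) → maximal , tr≡trace⇒⊨ᶜ Φ eq)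
        , (λ (maximal , c⊨Φ , eq) → maximal , ⊨ᶜ⇒tr≡trace c⊨Φ eq))
        (IsPrSet-tr enumeration (trace Φ))))
      (sym (PrSet-tr enumeration (trace Φ)))

  -- Trace distribution formulae as distributions

  sumList-tabulate : ∀ {f : X → ℝ} n (g : Fin n → X) {r : Fin n → ℝ} → (∀ i → f (g i) ≈ r i) →
                     sumList f (tabulate g) ≈ sumFin r
  sumList-tabulate zero    g f∘g≈r = refl
  sumList-tabulate (suc n) g f∘g≈r = +-cong (f∘g≈r zero) (sumList-tabulate n (g ∘ suc) (f∘g≈r ∘ suc))

  Unique⇒lookup-injective : ∀ {xs : List X} → Unique xs → Injective _≡_ _≡_ (lookup xs)
  Unique⇒lookup-injective (_ ∷ _)   {zero}  {zero}  _  = ≡.refl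
  Unique⇒lookup-injective (x≢ ∷ _)  {zero}  {suc j} eq = contradiction eq (All.lookup x≢ (∈-lookup j))
  Unique⇒lookup-injective (x≢ ∷ _)  {suc i} {zero}  eq = contradiction (≡.sym eq) (All.lookup x≢ (∈-lookup i))
  Unique⇒lookup-injective (_ ∷ xs!) {suc i} {suc j} eq = ≡.cong suc (Unique⇒lookup-injective xs! eq)

  module _ {A : Set} where

    module _ (Ψ : TraceDistFormula A) where

      open TraceDistFormula Ψ

      weight-Φ : ∀ i → weight (Φ i) ≈ r i
      weight-Φ i with lem {P = ∃[ j ] Φ j ≡ Φ i}
      ... | yes (_ , Φj≡Φi) = reflexive (≡.cong r (distinct Φj≡Φi))
      ... | no  none        = contradiction (i , ≡.refl) none

      weight-else : ∀ {φ} → ¬ (∃[ i ] Φ i ≡ φ) → weight φ ≈ 0#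
      weight-else {φ} none with lem {P = ∃[ i ] Φ i ≡ φ}
      ... | yes some = contradiction some none
      ... | no  _    = refl

      weight-≤ : ∀ {f : TraceFormula A → ℝ} → (∀ φ → 0# ≤ f φ) → (∀ i → r i ≤ f (Φ i)) → ∀ φ → weight φ ≤ f φ
      weight-≤ 0≤f r≤f φ with lem {P = ∃[ i ] Φ i ≡ φ}
      ... | yes (i , ≡.refl) = r≤f i
      ... | no  _            = 0≤f φ

      weightDist : Dist (TraceFormula A)
      weightDist = record
        { mass   = weight
        ; nonNeg = weight-nonNeg
        ; total  = tabulate Φ , Unique.tabulate⁺ {f = Φ} distinct ,
            (λ φ∉ → weight-else (λ { (i , ≡.refl) → φ∉ (∈-tabulate⁺ {f = Φ} i) })) ,
            trans (sumList-tabulate (suc n) Φ weight-Φ) total1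
        }
        where
        weight-nonNeg : ∀ φ → 0# ≤ weight φ
        weight-nonNeg φ with lem {P = ∃[ i ] Φ i ≡ φ}
        ... | yes (i , _) = proj₁ (positive i)
        ... | no  _       = ≤-refl

      -- Agreement at the listed formulae gives `weight φ ≤ mass μ φ` everywhere, as the weight of
      -- any other φ is 0. Equal totals then force equality, so μ has no mass elsewhere.
      weight≈mass : (μ : Dist (TraceFormula A)) → (∀ i → r i ≈ mass μ (Φ i)) → weightDist ≈ᴰ μ
      weight≈mass μ r≈μ = mass-≤⇒≈ weightDist μ (weight-≤ (nonNeg μ) (≤-reflexive ∘ r≈μ))

    formulaOf : (μ : Dist (TraceFormula A)) → ∃[ Ψ ] (weightDist Ψ ≈ᴰ μ)
    formulaOf μ with xs , xs! , μ≈0 , _ ← total μ =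
      -- The list taken from `total μ` may contain points of mass 0, whereas the weights of a
      -- formula are positive.
      fromSupport (filter supp? xs) (Unique.filter⁺ supp? xs!) (All.all-filter supp? xs)
        (IsSum-over (Unique.filter⁺ supp? xs!) off-support (total μ))
      where
      supp? : ∀ φ → Dec (φ ∈supp μ)
      supp? φ = lem

      off-support : ∀ {φ} → φ ∉ filter supp? xs → mass μ φ ≈ 0#
      off-support {φ} φ∉ with lem {P = φ ∈ xs}
      ... | no  φ∉xs = μ≈0 φ∉xs
      ... | yes φ∈xs = ¬0<⇒≈0 (nonNeg μ φ) (φ∉ ∘ ∈-filter⁺ supp? φ∈xs)

      fromSupport : ∀ φs → Unique φs → All (_∈supp μ) φs → sumList (mass μ) φs ≈ 1# → ∃[ Ψ ] (weightDist Ψ ≈ᴰ μ)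
      -- The index set of a formula is nonempty; an empty support would make the total mass 0.
      fromSupport []            _   _        0≈1  = contradiction (sym 0≈1) 1≉0
      fromSupport φs@(_ ∷ φs′) φs! positive sum≈1 = Ψ , weight≈mass Ψ μ (λ _ → refl)
        where
        Ψ : TraceDistFormula A
        Ψ = record
          { n        = List.length φs′
          ; r        = mass μ ∘ lookup φs
          ; Φ        = lookup φs
          ; distinct = Unique⇒lookup-injective φs!
          ; positive = λ i → All.lookup positive (∈-lookup {xs = φs} i)
          ; atMost1  = λ i → ≤-respʳ-≈ sum≈1 (∈⇒≤sumList φs (nonNeg μ) (∈-lookup {xs = φs} i))
          ; total1   = trans (sym (sumList-tabulate (List.length φs) (lookup φs) (λ _ → refl)))
                         (trans (reflexive (≡.cong (sumList (mass μ)) (tabulate-lookup φs))) sum≈1)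
          }

  -- Resolutions of a finite process and the formulae it satisfies

  module _ {A : Set} (P : PTS A) (finite : ∀ s → PTS.Finite P s) where

    open Process P

    module _ (𝓩 : Resolution) where

      open Resolution 𝓩
      open Computations pts

      -- By `matched`, `corr` maps an infinite path of the resolution to an infinite path of the
      -- process, with the same probability at every step.
      resolution-finite : ∀ z → Z.Finite z
      resolution-finite z (σ , σ0≡z , σ-steps) = finite (corr z)
        ( corr ∘ σ , ≡.cong corr σ0≡z
        , λ n → let a , π , t , 0≤π , 0≉π = σ-steps n
                    π′ , t′ , π≈π′ = matched t
                in a , π′ , t′ , ≤-respʳ-≈ (π≈π′ _) 0≤π , λ 0≈π′ → 0≉π (trans 0≈π′ (sym (π≈π′ _))))

      maximalEnumeration : MaximalEnumeration init
      maximalEnumeration = enumerate atMostOne (Finite⇒Acc (resolution-finite init))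

      TD-dist : Dist (List A)
      TD-dist = traceDist maximalEnumeration

      TD-formulaDist : Dist (TraceFormula A)
      TD-formulaDist = record
        { mass   = TD 𝓩 ∘ trace
        ; nonNeg = nonNeg TD-dist ∘ trace
        ; total  = IsSum-∘ trace-formula formula-trace (total TD-dist)
        }

      satisfaction : ∀ Φ → Z.PrSet {init} (λ c → Z.Maximal c × c Z.⊨ᶜ Φ × Z.length c ≡ depth Φ) ≈ TD 𝓩 (trace Φ)
      satisfaction = PrSet-⊨ᶜ maximalEnumeration

    infix 4 _≃_
    -- This is a relation and not a bijection: different resolutions may share a trace distribution,
    -- and a formula may list its components in any order.
    _≃_ : Resolution → TraceDistFormula A → Set
    𝓩 ≃ Ψ = weightDist Ψ ≈ᴰ TD-formulaDist 𝓩

    D-T≈D : ∀ {𝓩₁ 𝓩₂ Ψ₁ Ψ₂} → 𝓩₁ ≃ Ψ₁ → 𝓩₂ ≃ Ψ₂ → D-T 𝓩₁ 𝓩₂ ≈ D Ψ₁ Ψ₂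
    D-T≈D {𝓩₁} {𝓩₂} {Ψ₁} {Ψ₂} 𝓩₁≃Ψ₁ 𝓩₂≃Ψ₂ = sym (Kantorovich-∘
      (TD-dist 𝓩₁) (TD-dist 𝓩₂) (weightDist Ψ₁) (weightDist Ψ₂)
      trace-formula formula-trace 𝓩₁≃Ψ₁ 𝓩₂≃Ψ₂)

    res⇒𝓛 : ∀ {s 𝓩} → res s 𝓩 → ∃[ Ψ ] 𝓛 s Ψ × 𝓩 ≃ Ψ
    res⇒𝓛 {s} {𝓩} 𝓩∈res = Ψ , (𝓩 , 𝓩∈res , satisfied) , 𝓩≃Ψ
      where
      Ψ : TraceDistFormula A
      Ψ = proj₁ (formulaOf (TD-formulaDist 𝓩))

      open TraceDistFormula Ψ

      𝓩≃Ψ : 𝓩 ≃ Ψ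
      𝓩≃Ψ = proj₂ (formulaOf (TD-formulaDist 𝓩))

      satisfied : ∀ i → _ ≈ r i
      satisfied i = trans (satisfaction 𝓩 (Φ i)) (trans (sym (𝓩≃Ψ (Φ i))) (weight-Φ Ψ i))

    𝓛⇒res : ∀ {s Ψ} → 𝓛 s Ψ → ∃[ 𝓩 ] res s 𝓩 × 𝓩 ≃ Ψ
    𝓛⇒res {Ψ = Ψ} (𝓩 , 𝓩∈res , 𝓩⊨Ψ) = 𝓩 , 𝓩∈res , weight≈mass Ψ (TD-formulaDist 𝓩) (λ i →
      trans (sym (𝓩⊨Ψ i)) (satisfaction 𝓩 (TraceDistFormula.Φ Ψ i)))

    Hausdorff-res≈Hausdorff-𝓛 : ∀ s t → strongTraceMetric s t ≈ Hausdorff D (𝓛 s) (𝓛 t)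
    Hausdorff-res≈Hausdorff-𝓛 s t = Hausdorff-cong
      {d = D-T} {d′ = D} {P = res s} {Q = res t} {P′ = 𝓛 s} {Q′ = 𝓛 t} _≃_
      (λ {𝓩₁} {Ψ₁} {𝓩₂} {Ψ₂} → D-T≈D {𝓩₁} {𝓩₂} {Ψ₁} {Ψ₂})
      (λ {𝓩₁} {_} {𝓩₂} _ _ → Kantorovich-unit (TD-dist 𝓩₁) (TD-dist 𝓩₂))
      (λ {𝓩} → res⇒𝓛 {s} {𝓩}) 𝓛⇒res (λ {𝓩} → res⇒𝓛 {t} {𝓩}) 𝓛⇒res

    Hausdorff-𝓛≈sup : ∀ s t → Hausdorff D (𝓛 s) (𝓛 t) ≈ sup U (λ Ψ → ∣ ⟦ Ψ ⟧ s - ⟦ Ψ ⟧ t ∣)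
    Hausdorff-𝓛≈sup s t = Hausdorff≈sup-∣-∣ {d = D}
      (λ Ψ₁ Ψ₂ → Kantorovich-unit (weightDist Ψ₁) (weightDist Ψ₂))
      (λ Ψ → Kantorovich-self (weightDist Ψ))
      (λ Ψ₁ Ψ₂ Ψ₃ → Kantorovich-triangle (weightDist Ψ₁) (weightDist Ψ₂) (weightDist Ψ₃))
      (𝓛 s) (𝓛 t)

    logicalCharacterisation : ∀ s t → strongTraceMetric s t ≈ sup U (λ Ψ → ∣ ⟦ Ψ ⟧ s - ⟦ Ψ ⟧ t ∣)
    logicalCharacterisation s t = trans (Hausdorff-res≈Hausdorff-𝓛 s t) (Hausdorff-𝓛≈sup s t)

theorem20 : (lem : ∀ {ℓ} → ExcludedMiddle ℓ) (𝓡 : CompleteOrderedField) →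
    let open Theory lem 𝓡 in
    {A : Set} (P : PTS A) →
    let open Process P in
    (∀ s → ImageFinite s) → (∀ s → Finite s) →
    ∀ s t → strongTraceMetric s t ≈ sup U (λ Ψ → ∣ ⟦ Ψ ⟧ s - ⟦ Ψ ⟧ t ∣)
theorem20 lem 𝓡 P _ = Proof.logicalCharacterisation lem 𝓡 P
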